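{- Let $N=(\Gamma,B)$ be a network with $\Gamma=(V,E)$, and let $d=|V|$ and $n=|V\setminus B|$. Write the chromatic polynomial of $\Gamma$ and the precoloring polynomial of $N$ as $\chi_\Gamma(\lambda)=a_0\lambda^d-a_1\lambda^{d-1}+\cdots+(-1)^da_d$ and $\bar\chi_{M(N)}(\lambda)=b_0\lambda^n-b_1\lambda^{n-1}+\cdots+(-1)^nb_n$. Then $a_i\ge b_i$ for all $i=0,\dots,n$, with $a_i=b_i$ whenever $i$ is less than the minimum number of edges in a path in $\Gamma$ between distinct boundary nodes.
   Context: A network $N=(\Gamma,B)$ consists of a finite connected graph $\Gamma=(V,E)$ with no loops or multiple edges and a set $B\subsetneq V$ of at least 2 vertices (boundary nodes), no two of which are adjacent; vertices in $V\setminus B$ are interior. The Dirichlet matroid $M(N)$: fix an injective $u:B\to\mathbb{R}$ and a new symbol $e_0\notin E$; in $\mathbb{R}^{(V\setminus B)\cup\{0\}}$ assign to each edge $ij$ with $i,j$ interior the vector $\mathbf{e}_i-\mathbf{e}_j$, to each edge $ij$ with $i$ interior and $j\in B$ the vector $\mathbf{e}_i-u(j)\mathbf{e}_0$, and to $e_0$ the vector $\mathbf{e}_0$; $M(N)$ is the matroid of linear independence of these vectors on $E\cup\{e_0\}$ (independent of the choice of injective $u$). The precoloring polynomial of $N$ is the reduced characteristic polynomial $\bar\chi_{M(N)}(\lambda)=\chi_{M(N)}(\lambda)/(\lambda-1)$, where $\chi_{M(N)}$ is the characteristic polynomial of the matroid $M(N)$. $\chi_\Gamma$ is the chromatic polynomial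 of $\Gamma$. -}

module Defs where

open import Data.Nat as ℕ using (ℕ; zero; suc; _∸_)
open import Data.Integer as ℤ using (ℤ; +_; -1ℤ; 1ℤ)
open import Data.Rational as ℚ using (ℚ; 0ℚ; 1ℚ)
open import Data.Fin using (Fin; zero; suc; toℕ; fromℕ; _≟_)
open import Data.Fin.Subset using (Subset; _∈_; _∉_; _⊆_; ∣_∣; ⊤; ∁)
open import Data.Fin.Subset.Properties using (_∈?_)
open import Data.Vec using (Vec; []; _∷_; lookup)
open import Data.List using (List; []; _∷_; [_]; concatMap; map; length; filterᵇ; allFin; foldr)
open import Data.Bool using (Bool; true; false; if_then_else_; not; _∧_)
open import Data.Product using (Σ; ∃; ∃-syntax; _×_; _,_; proj₁; proj₂)
open import Data.Sum using (_⊎_)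
open import Relation.Nullary using (¬_; yes; no; does)
open import Relation.Binary.PropositionalEquality using (_≡_; _≢_)

sumℚ : ∀ {N} → (Fin N → ℚ) → ℚ
sumℚ {zero} f = 0ℚ
sumℚ {suc N} f = f zero ℚ.+ sumℚ (λ k → f (suc k))

sumℤ : ∀ {N} → (Fin N → ℤ) → ℤ
sumℤ {zero} f = + 0
sumℤ {suc N} f = f zero ℤ.+ sumℤ (λ k → f (suc k))

sumℤL : ∀ {A : Set} → (A → ℤ) → List A → ℤ
sumℤL f = foldr (λ x acc → f x ℤ.+ acc) (+ 0)

allSubsets : ∀ n → List (Subset n)
allSubsets zero = [ [] ]
allSubsets (suc n) = concatMap (λ s → (true ∷ s) ∷ (false ∷ s) ∷ []) (allSubsets n)

allVecs : ∀ k d → List (Vec (Fin k) d)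
allVecs k zero = [ [] ]
allVecs k (suc d) = concatMap (λ v → map (λ c → c ∷ v) (allFin k)) (allVecs k d)

-- Graphs: vertices Fin d, edges Fin m, each edge an ordered pair of endpoints
-- (the orientation is irrelevant).

record Graph : Set where
  field
    d    : ℕ
    m    : ℕ
    ends : Fin m → Fin d × Fin d
    noLoop  : ∀ e → proj₁ (ends e) ≢ proj₂ (ends e)
    noMulti : ∀ e f → (ends e ≡ ends f ⊎ (proj₁ (ends e) ≡ proj₂ (ends f) × proj₂ (ends e) ≡ proj₁ (ends f))) → e ≡ f

  Adj : Fin d → Fin d → Set
  Adj u v = ∃[ e ] (ends e ≡ (u , v) ⊎ ends e ≡ (v , u))

  IsPath : (ℓ : ℕ) → (Fin (suc ℓ) → Fin d) → Fin d → Fin d → Set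
  IsPath ℓ p s t =
    (p zero ≡ s) × (p (fromℕ ℓ) ≡ t)
    × (∀ (i j : Fin (suc ℓ)) → p i ≡ p j → i ≡ j)
    × (∀ (i : Fin ℓ) → Adj (p (Data.Fin.inject₁ i)) (p (suc i)))

  Connected : Set
  Connected = ∀ u v → ∃[ ℓ ] Σ (Fin (suc ℓ) → Fin d) (λ p → IsPath ℓ p u v)

  properᵇ : ∀ {k} → Vec (Fin k) d → Bool
  properᵇ c = foldr _∧_ true
    (map (λ e → not (does (lookup c (proj₁ (ends e)) ≟ lookup c (proj₂ (ends e))))) (allFin m))

  numColourings : ℕ → ℕ
  numColourings k = length (filterᵇ properᵇ (allVecs k d))

record Network : Set where
  field
    Γ : Graph
  open Graph Γ public
  field
    B          : Subset d
    connected  : Connected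
    twoBoundary : 2 ℕ.≤ ∣ B ∣
    properSub  : ∃[ v ] (v ∉ B)
    bdryNonAdj : ∀ e → ¬ (proj₁ (ends e) ∈ B × proj₂ (ends e) ∈ B)

  n : ℕ
  n = ∣ ∁ B ∣

  -- Dirichlet matroid.  Coordinates: Fin (suc d), coordinate zero is e₀,
  -- coordinate suc v is vertex v (boundary coordinates are never used).
  -- Injective boundary labelling u(j) = toℕ j.

  uB : Fin d → ℚ
  uB j = (+ toℕ j) ℚ./ 1

  unit : Fin (suc d) → Fin (suc d) → ℚ
  unit i x = if does (i ≟ x) then 1ℚ else 0ℚ

  edgeVec : Fin d → Fin d → Fin (suc d) → ℚ
  edgeVec i j x with i ∈? B | j ∈? B
  ... | no _  | no _  = unit (suc i) x ℚ.- unit (suc j) x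
  ... | no _  | yes _ = unit (suc i) x ℚ.- uB j ℚ.* unit zero x
  ... | yes _ | no _  = unit (suc j) x ℚ.- uB i ℚ.* unit zero x
  ... | yes _ | yes _ = 0ℚ   -- never happens (bdryNonAdj)

  -- ground set E ∪ {e₀}: zero is e₀, suc e is edge e
  vec : Fin (suc m) → Fin (suc d) → ℚ
  vec zero x = unit zero x
  vec (suc e) x = edgeVec (proj₁ (ends e)) (proj₂ (ends e)) x

  Independent : Subset (suc m) → Set
  Independent S = ∀ (c : Fin (suc m) → ℚ)
    → (∀ k → k ∉ S → c k ≡ 0ℚ)
    → (∀ x → sumℚ (λ k → c k ℚ.* vec k x) ≡ 0ℚ)
    → ∀ k → c k ≡ 0ℚ

  IsRankFn : (Subset (suc m) → ℕ) → Set
  IsRankFn r = ∀ S →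
    (∃[ T ] (T ⊆ S × Independent T × ∣ T ∣ ≡ r S))
    × (∀ T → T ⊆ S → Independent T → ∣ T ∣ ℕ.≤ r S)

  charPoly : (Subset (suc m) → ℕ) → ℤ → ℤ
  charPoly r λ' = sumℤL (λ A → (-1ℤ ℤ.^ ∣ A ∣) ℤ.* (λ' ℤ.^ (r ⊤ ∸ r A))) (allSubsets (suc m))

  BelowBoundaryDistance : ℕ → Set
  BelowBoundaryDistance i = ∀ s t → s ∈ B → t ∈ B → s ≢ t →
    ∀ ℓ (p : Fin (suc ℓ) → Fin d) → IsPath ℓ p s t → i ℕ.< ℓ

altPoly : ℕ → (ℕ → ℤ) → ℤ → ℤ
altPoly D c λ' = sumℤ {suc D} (λ i → (-1ℤ ℤ.^ toℕ i) ℤ.* c (toℕ i) ℤ.* (λ' ℤ.^ (D ∸ toℕ i)))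

{-# OPTIONS --safe #-}
module Submission where

-- Both polynomials are Whitney sums over edge sets A, graded by the rank ρ(A) of the partition of V into
-- the components of A:
--   χ_Γ(λ) = Σ_A (-1)^|A| λ^(d-ρ(A)),   χ̄_M(N)(λ) = Σ_(A balanced) (-1)^|A| λ^(n-ρ(A)),
-- where A is balanced if no component contains two boundary nodes. For the second formula, e₀ lies in the
-- span of an unbalanced A, so the terms of A and A ∪ e₀ cancel; for balanced A adding e₀ raises the rank by
-- one, and the two terms differ by the factor λ - 1. Hence (-1)^i (a_i - b_i) is the signed number of
-- unbalanced A of rank i. Being unbalanced of rank i depends only on the partition, and for every
-- function of that kind supported in rank i the alternating sum has sign (-1)^i, by
-- deletion–contraction. An unbalanced A contains a path between boundary nodes, of length at most ρ(A),
-- which gives the equality below the boundary distance.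

open import Defs
open import Data.Nat using (ℕ; _≤_)
open import Data.Integer as ℤ using (ℤ; +_; 1ℤ)
open import Data.Fin.Subset using (Subset)
open import Data.Fin using (Fin)
open import Data.Product using (_×_)
open import Relation.Binary.PropositionalEquality using (_≡_)

open import Data.Bool using (Bool; true; false; if_then_else_; not; _∧_)
open import Data.Fin using (zero; suc; toℕ; fromℕ; inject₁; _≟_)
import Data.Fin.Properties as Fin
open import Data.Fin.Subset using (_∈_; _∉_; _⊆_; ∣_∣; inside; outside; ∁; ⊥; ⊤)
open import Data.Fin.Subset.Properties
  using (_∈?_; ∉⊥; ∈⊤; ⊆⊤; ∣⊥∣≡0; ∣p∣≤n; nonempty?; Empty-unique; p⊆q⇒∣p∣≤∣q∣)
open import Data.Integer using (-1ℤ; 0ℤ)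
import Data.Integer.Properties as ℤₚ
import Data.Integer.Solver as ℤ-Solver
open import Data.List using (List; []; _∷_; _++_; map; concatMap; allFin; foldr; length; filterᵇ)
open import Data.List.Properties using (map-tabulate)
open import Data.Maybe as Maybe using (Maybe; just; nothing)
import Data.Nat as ℕ
open import Data.Nat using (zero; suc; _∸_)
import Data.Nat.Properties as ℕₚ
open import Data.Product using (Σ; ∃; ∃-syntax; _,_; proj₁; proj₂)
open import Data.Rational as ℚ using (ℚ; 0ℚ; 1ℚ)
import Data.Rational.Properties as ℚₚ
import Data.Rational.Solver as ℚ-Solver
import Data.Rational.Unnormalised as ℚᵘ
open import Data.Sum using (_⊎_; inj₁; inj₂; swap)
open import Data.Unit using (tt) renaming (⊤ to Unit)
open import Data.Vec using (Vec; []; _∷_; here; there; lookup; _[_]≔_)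
open import Data.Vec.Properties
  using ([]≔-updates; []≔-minimal; []≔-idempotent; []≔-lookup; []=⇒lookup; []=-injective)
open import Function using (_∘_; id; _on_)
open import Relation.Binary.Construct.Closure.ReflexiveTransitive using (Star; ε; _◅_; _◅◅_; reverse)
import Relation.Binary.Construct.On as On
open import Relation.Binary.Definitions using (tri<; tri≈; tri>)
open import Relation.Binary.PropositionalEquality
  using (_≢_; refl; sym; trans; cong; cong₂; subst; subst₂; isEquivalence; module ≡-Reasoning)
open import Relation.Binary.Structures using (IsEquivalence)
open import Relation.Nullary using (¬_; Dec; yes; no; does; contradiction)
open import Relation.Nullary.Decidable using (¬?; _×-dec_; decidable-stable; dec-true; dec-false)

open ≡-Reasoning

-- The rank function is known only through its defining property, so it is computed one edge at a
-- time by duality: an element raises the rank exactly when some linear functional vanishes on the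
-- set but not on the element. A functional killing an edge set is a potential constant on its
-- components, with the boundary potentials tied to the coordinate of `e₀`; this is where components
-- enter. The obstacle is order. Rank arguments insert an edge anywhere, while the forest of an edge
-- set is built in list order and depends on it. Hence a partition is handled through `Resp`, that
-- is, through the equivalence relations containing it; these determine the number of classes. In
-- the sign statement the weight is subject only to a sign condition and the starting partition
-- varies, since contracting an edge changes only the starting partition. Rank `i` fixes the parity
-- of the number of classes, and with it the sign at the end of the recursion. The factor `λ - 1` is
-- cancelled pointwise, so coefficients are compared on the integers from 2 on, through divisibility
-- of the constant term.

module ℤS = ℤ-Solver.+-*-Solver
module ℚS = ℚ-Solver.+-*-Solver

-- Sums over lists of integers

module _ {X : Set} where

  sumL-cong : ∀ {f g : X → ℤ} → (∀ x → f x ≡ g x) → ∀ xs → sumℤL f xs ≡ sumℤL g xs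
  sumL-cong f≈g []       = refl
  sumL-cong f≈g (x ∷ xs) = cong₂ ℤ._+_ (f≈g x) (sumL-cong f≈g xs)

  sumL-++ : ∀ (f : X → ℤ) xs ys → sumℤL f (xs ++ ys) ≡ sumℤL f xs ℤ.+ sumℤL f ys
  sumL-++ f []       ys = sym (ℤₚ.+-identityˡ _)
  sumL-++ f (x ∷ xs) ys = trans (cong (λ t → f x ℤ.+ t) (sumL-++ f xs ys)) (sym (ℤₚ.+-assoc (f x) _ _))

  sumL-+ : ∀ (f g : X → ℤ) xs → sumℤL (λ x → f x ℤ.+ g x) xs ≡ sumℤL f xs ℤ.+ sumℤL g xs
  sumL-+ f g []       = refl
  sumL-+ f g (x ∷ xs) = trans (cong (λ t → (f x ℤ.+ g x) ℤ.+ t) (sumL-+ f g xs))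
    (ℤS.solve 4 (λ a b c d → (a ℤS.:+ b) ℤS.:+ (c ℤS.:+ d) ℤS.:= (a ℤS.:+ c) ℤS.:+ (b ℤS.:+ d)) refl
      (f x) (g x) (sumℤL f xs) (sumℤL g xs))

  sumL-*ˡ : ∀ q (f : X → ℤ) xs → sumℤL (λ x → q ℤ.* f x) xs ≡ q ℤ.* sumℤL f xs
  sumL-*ˡ q f []       = sym (ℤₚ.*-zeroʳ q)
  sumL-*ˡ q f (x ∷ xs) = trans (cong (λ t → q ℤ.* f x ℤ.+ t) (sumL-*ˡ q f xs)) (sym (ℤₚ.*-distribˡ-+ q (f x) _))

  sumL-0 : ∀ (xs : List X) → sumℤL (λ _ → 0ℤ) xs ≡ 0ℤ
  sumL-0 []       = refl
  sumL-0 (x ∷ xs) = trans (ℤₚ.+-identityˡ _) (sumL-0 xs)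

  length-filterᵇ : ∀ (p : X → Bool) xs → + length (filterᵇ p xs) ≡ sumℤL (λ x → if p x then 1ℤ else 0ℤ) xs
  length-filterᵇ p [] = refl
  length-filterᵇ p (x ∷ xs) with p x
  ... | true  = cong (λ t → 1ℤ ℤ.+ t) (length-filterᵇ p xs)
  ... | false = trans (length-filterᵇ p xs) (sym (ℤₚ.+-identityˡ _))

module _ {X Y : Set} where

  sumL-map : ∀ (f : Y → ℤ) (g : X → Y) xs → sumℤL f (map g xs) ≡ sumℤL (f ∘ g) xs
  sumL-map f g []       = refl
  sumL-map f g (x ∷ xs) = cong (λ t → f (g x) ℤ.+ t) (sumL-map f g xs)

  sumL-concatMap : ∀ (f : Y → ℤ) (g : X → List Y) xs →
    sumℤL f (concatMap g xs) ≡ sumℤL (λ x → sumℤL f (g x)) xs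
  sumL-concatMap f g []       = refl
  sumL-concatMap f g (x ∷ xs) = trans (sumL-++ f (g x) _) (cong (λ t → sumℤL f (g x) ℤ.+ t) (sumL-concatMap f g xs))

  sumL-swap : ∀ (f : X → Y → ℤ) xs ys →
    sumℤL (λ x → sumℤL (f x) ys) xs ≡ sumℤL (λ y → sumℤL (λ x → f x y) xs) ys
  sumL-swap f []       ys = sym (sumL-0 ys)
  sumL-swap f (x ∷ xs) ys = trans (cong (λ t → sumℤL (f x) ys ℤ.+ t) (sumL-swap f xs ys)) (sym (sumL-+ (f x) _ ys))

sumL-allSubsets : ∀ {m} (f : Subset (suc m) → ℤ) →
  sumℤL f (allSubsets (suc m)) ≡ sumℤL (λ A → f (true ∷ A) ℤ.+ f (false ∷ A)) (allSubsets m)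
sumL-allSubsets {m} f = trans (sumL-concatMap f _ (allSubsets m))
  (sumL-cong (λ A → cong (λ t → f (true ∷ A) ℤ.+ t) (ℤₚ.+-identityʳ _)) (allSubsets m))

sumL-allVecs : ∀ {k d} (f : Vec (Fin k) (suc d) → ℤ) →
  sumℤL f (allVecs k (suc d)) ≡ sumℤL (λ v → sumℤL (λ c → f (c ∷ v)) (allFin k)) (allVecs k d)
sumL-allVecs {k} {d} f = trans (sumL-concatMap f _ (allVecs k d))
  (sumL-cong (λ v → sumL-map f (_∷ v) (allFin k)) (allVecs k d))

sumL-allFin-suc : ∀ {k} (f : Fin (suc k) → ℤ) → sumℤL f (allFin (suc k)) ≡ f zero ℤ.+ sumℤL (f ∘ suc) (allFin k)
sumL-allFin-suc {k} f = cong (λ t → f zero ℤ.+ t)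
  (trans (cong (sumℤL f) (sym (map-tabulate id suc))) (sumL-map f suc (allFin k)))

ι : ∀ {P : Set} → Dec P → ℤ
ι P? = if does P? then 1ℤ else 0ℤ

ι-yes : ∀ {P : Set} (P? : Dec P) → P → ι P? ≡ 1ℤ
ι-yes P? p rewrite dec-true P? p = refl

ι-no : ∀ {P : Set} (P? : Dec P) → ¬ P → ι P? ≡ 0ℤ
ι-no P? ¬p rewrite dec-false P? ¬p = refl

ι-cong : ∀ {P Q : Set} (P? : Dec P) (Q? : Dec Q) → (P → Q) → (Q → P) → ι P? ≡ ι Q?
ι-cong (yes p) Q? P→Q Q→P = sym (ι-yes Q? (P→Q p))
ι-cong (no ¬p) Q? P→Q Q→P = sym (ι-no Q? (¬p ∘ Q→P))

ι-× : ∀ {P Q : Set} (P? : Dec P) (Q? : Dec Q) → ι (P? ×-dec Q?) ≡ ι P? ℤ.* ι Q?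
ι-× (yes p) Q? = sym (ℤₚ.*-identityˡ _)
ι-× (no ¬p) Q? = sym (ℤₚ.*-zeroˡ (ι Q?))

ι-¬ : ∀ {P : Set} (P? : Dec P) → ι (¬? P?) ≡ 1ℤ ℤ.- ι P?
ι-¬ (yes p) = refl
ι-¬ (no ¬p) = refl

sumL-const : ∀ k q → sumℤL (λ _ → q) (allFin k) ≡ + k ℤ.* q
sumL-const zero    q = sym (ℤₚ.*-zeroˡ q)
sumL-const (suc k) q = trans (sumL-allFin-suc {k} (λ _ → q))
  (trans (cong (λ t → q ℤ.+ t) (sumL-const k q)) (sym (ℤₚ.suc-* (+ k) q)))

sumL-ι≟ : ∀ {k} (x : Fin k) → sumℤL (λ c → ι (c ≟ x)) (allFin k) ≡ 1ℤ
sumL-ι≟ {suc k} zero = trans (sumL-allFin-suc {k} (λ c → ι (c ≟ zero))) (cong (λ t → 1ℤ ℤ.+ t) (sumL-0 (allFin k)))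
sumL-ι≟ {suc k} (suc x) = trans (sumL-allFin-suc (λ c → ι (c ≟ suc x)))
  (trans (ℤₚ.+-identityˡ _) (trans
    (sumL-cong (λ c → ι-cong (suc c ≟ suc x) (c ≟ x) Fin.suc-injective (cong suc)) (allFin k)) (sumL-ι≟ x)))

-- Partitions and alternating sums over edge sets

-- A partition of Fin d: every vertex is a root or has a parent among the later vertices.
data Forest : ℕ → Set where
  []  : Forest zero
  _∷_ : ∀ {d} → Maybe (Fin d) → Forest d → Forest (suc d)

find : ∀ {d} → Forest d → Fin d → Fin d
find (nothing ∷ F) zero    = zero
find (just p  ∷ F) zero    = suc (find F p)
find (x       ∷ F) (suc v) = suc (find F v)

roots : ∀ {d} → Forest d → ℕ
roots []            = 0
roots (nothing ∷ F) = suc (roots F)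
roots (just _  ∷ F) = roots F

discrete : ∀ d → Forest d
discrete zero    = []
discrete (suc d) = nothing ∷ discrete d

-- A head that already has a parent `p` is not relinked; the merge is passed on to `p` in the tail.
-- Parents thus stay later than their children, and the recursion is structural.
union : ∀ {d} → Forest d → Fin d → Fin d → Forest d
union (x       ∷ F) zero    zero    = x ∷ F
union (nothing ∷ F) zero    (suc v) = just v ∷ F
union (just p  ∷ F) zero    (suc v) = just p ∷ union F p v
union (nothing ∷ F) (suc u) zero    = just u ∷ F
union (just p  ∷ F) (suc u) zero    = just p ∷ union F u p
union (x       ∷ F) (suc u) (suc v) = x ∷ union F u v

-- The parent links of F lie in R; for an equivalence relation R this says that R identifies the
-- vertices of each class.
Resp : ∀ {d} → Forest d → (Fin d → Fin d → Set) → Set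
Resp []            R = Unit
Resp (nothing ∷ F) R = Resp F (R on suc)
Resp (just p  ∷ F) R = R zero (suc p) × Resp F (R on suc)

Resp? : ∀ {d} (F : Forest d) {R} → (∀ u v → Dec (R u v)) → Dec (Resp F R)
Resp? []            R? = yes tt
Resp? (nothing ∷ F) R? = Resp? F (λ u v → R? (suc u) (suc v))
Resp? (just p  ∷ F) R? = R? zero (suc p) ×-dec Resp? F (λ u v → R? (suc u) (suc v))

Resp-mono : ∀ {d} (F : Forest d) {R S : Fin d → Fin d → Set} → (∀ u v → R u v → S u v) → Resp F R → Resp F S
Resp-mono []            R⊆S _       = tt
Resp-mono (nothing ∷ F) R⊆S rF      = Resp-mono F (λ u v → R⊆S (suc u) (suc v)) rF
Resp-mono (just p  ∷ F) R⊆S (r , rF) = R⊆S zero (suc p) r , Resp-mono F (λ u v → R⊆S (suc u) (suc v)) rF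

Resp-discrete : ∀ d {R} → Resp (discrete d) R
Resp-discrete zero    = tt
Resp-discrete (suc d) = Resp-discrete d

Resp-find : ∀ {d} (F : Forest d) → Resp F (λ u v → find F u ≡ find F v)
Resp-find []            = tt
Resp-find (nothing ∷ F) = Resp-mono F (λ u v → cong suc) (Resp-find F)
Resp-find (just p  ∷ F) = refl , Resp-mono F (λ u v → cong suc) (Resp-find F)

Resp⇒find : ∀ {d} {R : Fin d → Fin d → Set} → IsEquivalence R → ∀ F → Resp F R → ∀ u → R u (find F u)
Resp⇒find R-eq (nothing ∷ F) rF       zero    = IsEquivalence.refl R-eq
Resp⇒find R-eq (just p  ∷ F) (r , rF) zero    = IsEquivalence.trans R-eq r (Resp⇒find (On.isEquivalence suc R-eq) F rF p)
Resp⇒find R-eq (nothing ∷ F) rF       (suc u) = Resp⇒find (On.isEquivalence suc R-eq) F rF u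
Resp⇒find R-eq (just p  ∷ F) (r , rF) (suc u) = Resp⇒find (On.isEquivalence suc R-eq) F rF u

-- Both vertices are related to their common root. Applied below with potentials, with other
-- partitions and with reachability in the role of `R`.
Resp⇒R : ∀ {d} {R : Fin d → Fin d → Set} → IsEquivalence R → ∀ F → Resp F R → ∀ {u v} → find F u ≡ find F v → R u v
Resp⇒R {R = R} R-eq F rF {u} {v} eq = R.trans (Resp⇒find R-eq F rF u)
  (subst (λ w → R w v) (sym eq) (R.sym (Resp⇒find R-eq F rF v)))
  where module R = IsEquivalence R-eq

-- Together with `Resp-union⁻` the universal property of `union` as a join of partitions. Later
-- arguments use it in place of the shape of the forest.
Resp-union⁺ : ∀ {d} {R : Fin d → Fin d → Set} → IsEquivalence R → ∀ F u v → Resp F R → R u v → Resp (union F u v) R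
Resp-union⁺ R-eq (x       ∷ F) zero    zero    rF       ruv = rF
Resp-union⁺ R-eq (nothing ∷ F) zero    (suc v) rF       ruv = ruv , rF
Resp-union⁺ R-eq (just p  ∷ F) zero    (suc v) (r , rF) ruv =
  r , Resp-union⁺ (On.isEquivalence suc R-eq) F p v rF (IsEquivalence.trans R-eq (IsEquivalence.sym R-eq r) ruv)
Resp-union⁺ R-eq (nothing ∷ F) (suc u) zero    rF       ruv = IsEquivalence.sym R-eq ruv , rF
Resp-union⁺ R-eq (just p  ∷ F) (suc u) zero    (r , rF) ruv =
  r , Resp-union⁺ (On.isEquivalence suc R-eq) F u p rF (IsEquivalence.trans R-eq ruv r)
Resp-union⁺ R-eq (nothing ∷ F) (suc u) (suc v) rF       ruv = Resp-union⁺ (On.isEquivalence suc R-eq) F u v rF ruv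
Resp-union⁺ R-eq (just p  ∷ F) (suc u) (suc v) (r , rF) ruv = r , Resp-union⁺ (On.isEquivalence suc R-eq) F u v rF ruv

Resp-union⁻ : ∀ {d} {R : Fin d → Fin d → Set} → IsEquivalence R → ∀ F u v → Resp (union F u v) R → Resp F R × R u v
Resp-union⁻ R-eq (x       ∷ F) zero    zero    rF         = rF , IsEquivalence.refl R-eq
Resp-union⁻ R-eq (nothing ∷ F) zero    (suc v) (ruv , rF) = rF , ruv
Resp-union⁻ R-eq (just p  ∷ F) zero    (suc v) (r , rU) with Resp-union⁻ (On.isEquivalence suc R-eq) F p v rU
... | rF , rpv = (r , rF) , IsEquivalence.trans R-eq r rpv
Resp-union⁻ R-eq (nothing ∷ F) (suc u) zero    (ruv , rF) = rF , IsEquivalence.sym R-eq ruv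
Resp-union⁻ R-eq (just p  ∷ F) (suc u) zero    (r , rU) with Resp-union⁻ (On.isEquivalence suc R-eq) F u p rU
... | rF , rup = (r , rF) , IsEquivalence.trans R-eq rup (IsEquivalence.sym R-eq r)
Resp-union⁻ R-eq (nothing ∷ F) (suc u) (suc v) rU = Resp-union⁻ (On.isEquivalence suc R-eq) F u v rU
Resp-union⁻ R-eq (just p  ∷ F) (suc u) (suc v) (r , rU) with Resp-union⁻ (On.isEquivalence suc R-eq) F u v rU
... | rF , ruv = (r , rF) , ruv

-- In the first case the forest itself is unchanged, not merely its partition; deletion-contraction
-- with an arbitrary weight on forests relies on this.
union-cases : ∀ {d} (F : Forest d) u v →
  (find F u ≡ find F v × union F u v ≡ F) ⊎ (find F u ≢ find F v × suc (roots (union F u v)) ≡ roots F)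
union-cases (x       ∷ F) zero    zero    = inj₁ (refl , refl)
union-cases (nothing ∷ F) zero    (suc v) = inj₂ ((λ ()) , refl)
union-cases (just p  ∷ F) zero    (suc v) with union-cases F p v
... | inj₁ (eq , U≡F) = inj₁ (cong suc eq , cong (just p ∷_) U≡F)
... | inj₂ (ne , r≡)  = inj₂ (ne ∘ Fin.suc-injective , r≡)
union-cases (nothing ∷ F) (suc u) zero    = inj₂ ((λ ()) , refl)
union-cases (just p  ∷ F) (suc u) zero    with union-cases F u p
... | inj₁ (eq , U≡F) = inj₁ (cong suc eq , cong (just p ∷_) U≡F)
... | inj₂ (ne , r≡)  = inj₂ (ne ∘ Fin.suc-injective , r≡)
union-cases (nothing ∷ F) (suc u) (suc v) with union-cases F u v
... | inj₁ (eq , U≡F) = inj₁ (cong suc eq , cong (nothing ∷_) U≡F)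
... | inj₂ (ne , r≡)  = inj₂ (ne ∘ Fin.suc-injective , cong suc r≡)
union-cases (just p  ∷ F) (suc u) (suc v) with union-cases F u v
... | inj₁ (eq , U≡F) = inj₁ (cong suc eq , cong (just p ∷_) U≡F)
... | inj₂ (ne , r≡)  = inj₂ (ne ∘ Fin.suc-injective , r≡)

roots≤ : ∀ {d} (F : Forest d) → roots F ℕ.≤ d
roots≤ []            = ℕ.z≤n
roots≤ (nothing ∷ F) = ℕ.s≤s (roots≤ F)
roots≤ (just _  ∷ F) = ℕₚ.m≤n⇒m≤1+n (roots≤ F)

roots-discrete : ∀ d → roots (discrete d) ≡ d
roots-discrete zero    = refl
roots-discrete (suc d) = cong suc (roots-discrete d)

-- A head without parent forms a class of its own, so in the connected case no vertex can follow it.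
roots-connected : ∀ {d} (F : Forest d) → Fin d → (∀ u v → find F u ≡ find F v) → roots F ≡ 1
roots-connected (nothing ∷ [])        _ conn = refl
roots-connected (nothing ∷ (y ∷ F))   _ conn with conn zero (suc zero)
... | ()
roots-connected (just p ∷ F@(_ ∷ _)) _ conn = roots-connected F zero (λ u v → Fin.suc-injective (conn (suc u) (suc v)))

-- Colourings constant on the classes of a partition

Mono : ∀ {k d} → Vec (Fin k) d → Fin d → Fin d → Set
Mono c u v = lookup c u ≡ lookup c v

Mono? : ∀ {k d} (c : Vec (Fin k) d) u v → Dec (Mono c u v)
Mono? c u v = lookup c u ≟ lookup c v

Mono-eq : ∀ {k d} (c : Vec (Fin k) d) → IsEquivalence (Mono c)
Mono-eq c = On.isEquivalence (lookup c) isEquivalence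

respects : ∀ {k d} → Forest d → Vec (Fin k) d → ℤ
respects F c = ι (Resp? F (Mono? c))

-- The colour of a root is free, a factor `k`; the colour of any other vertex is forced by its
-- parent.
count-respects : ∀ k {d} (F : Forest d) → sumℤL (respects F) (allVecs k d) ≡ (+ k) ℤ.^ roots F
count-respects k [] = refl
count-respects k (nothing ∷ F) = trans (sumL-allVecs (respects (nothing ∷ F)))
  (trans (sumL-cong (λ v → sumL-const k (respects F v)) (allVecs k _))
  (trans (sumL-*ˡ (+ k) (respects F) (allVecs k _)) (cong (+ k ℤ.*_) (count-respects k F))))
count-respects k (just p ∷ F) = trans (sumL-allVecs (respects (just p ∷ F)))
  (trans (sumL-cong step (allVecs k _)) (count-respects k F))
  where
  step : ∀ v → sumℤL (λ c → respects (just p ∷ F) (c ∷ v)) (allFin k) ≡ respects F v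
  step v = trans
    (sumL-cong (λ c → trans (ι-× (c ≟ lookup v p) (Resp? F (Mono? v))) (ℤₚ.*-comm _ (respects F v))) (allFin k))
    (trans (sumL-*ˡ (respects F v) (λ c → ι (c ≟ lookup v p)) (allFin k))
      (trans (cong (respects F v ℤ.*_) (sumL-ι≟ (lookup v p))) (ℤₚ.*-identityʳ _)))

-- Compare the numbers of 2-colourings constant on classes.
roots-unique : ∀ {d} (F G : Forest d) →
  (∀ {R} → IsEquivalence R → Resp F R → Resp G R) → (∀ {R} → IsEquivalence R → Resp G R → Resp F R) → roots F ≡ roots G
roots-unique {d} F G F⇒G G⇒F = 2^-injective (roots F) (roots G) (ℤₚ.+-injective (begin
    + (2 ℕ.^ roots F)               ≡⟨ pos-^ (roots F) ⟩
    (+ 2) ℤ.^ roots F               ≡⟨ count-respects 2 F ⟨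
    sumℤL (respects F) (allVecs 2 d)
      ≡⟨ sumL-cong (λ c → ι-cong (Resp? F (Mono? c)) (Resp? G (Mono? c)) (F⇒G (Mono-eq c)) (G⇒F (Mono-eq c)))
           (allVecs 2 d) ⟩
    sumℤL (respects G) (allVecs 2 d)  ≡⟨ count-respects 2 G ⟩
    (+ 2) ℤ.^ roots G               ≡⟨ pos-^ (roots G) ⟨
    + (2 ℕ.^ roots G)               ∎))
  where
  pos-^ : ∀ n → + (2 ℕ.^ n) ≡ (+ 2) ℤ.^ n
  pos-^ zero    = refl
  pos-^ (suc n) = trans (ℤₚ.pos-* 2 (2 ℕ.^ n)) (cong (+ 2 ℤ.*_) (pos-^ n))
  2^-injective : ∀ m n → 2 ℕ.^ m ≡ 2 ℕ.^ n → m ≡ n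
  2^-injective m n eq with ℕₚ.<-cmp m n
  ... | tri< m<n _ _ = contradiction eq (ℕₚ.<⇒≢ (ℕₚ.^-monoʳ-< 2 (ℕ.s≤s (ℕ.s≤s ℕ.z≤n)) m<n))
  ... | tri≈ _ m≡n _ = m≡n
  ... | tri> _ _ n<m = contradiction (sym eq) (ℕₚ.<⇒≢ (ℕₚ.^-monoʳ-< 2 (ℕ.s≤s (ℕ.s≤s ℕ.z≤n)) n<m))

-- Partitions generated by edge sets

Ends : ℕ → ℕ → Set
Ends d m = Fin m → Fin d × Fin d

state : ∀ {d m} → Ends d m → Subset m → Forest d → Forest d
state ends []          F = F
state ends (false ∷ A) F = state (ends ∘ suc) A F
state ends (true  ∷ A) F = state (ends ∘ suc) A (union F (proj₁ (ends zero)) (proj₂ (ends zero)))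

module _ {d} {R : Fin d → Fin d → Set} (R-eq : IsEquivalence R) where

  Respects : ∀ {m} → Ends d m → Subset m → Set
  Respects ends A = ∀ e → e ∈ A → R (proj₁ (ends e)) (proj₂ (ends e))

  -- With `Resp-state⁻`, describes the partition generated by `F` and the edges of `A` without
  -- reference to the order in which they were merged.
  Resp-state⁺ : ∀ {m} (ends : Ends d m) A {F} → Resp F R → Respects ends A → Resp (state ends A F) R
  Resp-state⁺ ends []          rF rA = rF
  Resp-state⁺ ends (false ∷ A) rF rA = Resp-state⁺ (ends ∘ suc) A rF (λ e → rA (suc e) ∘ there)
  Resp-state⁺ ends (true  ∷ A) {F} rF rA =
    Resp-state⁺ (ends ∘ suc) A (Resp-union⁺ R-eq F _ _ rF (rA zero here)) (λ e → rA (suc e) ∘ there)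

  Resp-state⁻ : ∀ {m} (ends : Ends d m) A {F} → Resp (state ends A F) R → Resp F R × Respects ends A
  Resp-state⁻ ends []          rS = rS , λ _ ()
  Resp-state⁻ ends (false ∷ A) rS with Resp-state⁻ (ends ∘ suc) A rS
  ... | rF , rA = rF , λ { (suc e) (there e∈A) → rA e e∈A }
  Resp-state⁻ ends (true ∷ A) {F} rS with Resp-state⁻ (ends ∘ suc) A rS
  ... | rU , rA with Resp-union⁻ R-eq F _ _ rU
  ...   | rF , r₀ = rF , λ { zero _ → r₀ ; (suc e) (there e∈A) → rA e e∈A }

sgn : ∀ {m} → Subset m → ℤ
sgn A = -1ℤ ℤ.^ ∣ A ∣

-- The starting partition is a parameter so that contraction stays in the family: deleting the first
-- edge keeps `F`, contracting it replaces `F` by a `union`.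
alt : ∀ {d m} → Ends d m → (Forest d → ℤ) → Forest d → ℤ
alt {m = m} ends W F = sumℤL (λ A → sgn A ℤ.* W (state ends A F)) (allSubsets m)

alt-suc : ∀ {d m} (ends : Ends d (suc m)) W F →
  alt ends W F ≡ alt (ends ∘ suc) W F ℤ.- alt (ends ∘ suc) W (union F (proj₁ (ends zero)) (proj₂ (ends zero)))
alt-suc {m = m} ends W F = begin
  alt ends W F
    ≡⟨ sumL-allSubsets (λ A → sgn A ℤ.* W (state ends A F)) ⟩
  sumℤL (λ A → sgn (true ∷ A) ℤ.* W (state (ends ∘ suc) A U) ℤ.+ sgn A ℤ.* W (state (ends ∘ suc) A F)) (allSubsets m)
    ≡⟨ sumL-cong (λ A → ℤS.solve 3 (λ s p q → (ℤS.con -1ℤ ℤS.:* s) ℤS.:* p ℤS.:+ q ℤS.:= q ℤS.:+ ℤS.con -1ℤ ℤS.:* (s ℤS.:* p)) refl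
         (sgn A) (W (state (ends ∘ suc) A U)) (sgn A ℤ.* W (state (ends ∘ suc) A F))) (allSubsets m) ⟩
  sumℤL (λ A → sgn A ℤ.* W (state (ends ∘ suc) A F) ℤ.+ -1ℤ ℤ.* (sgn A ℤ.* W (state (ends ∘ suc) A U))) (allSubsets m)
    ≡⟨ sumL-+ (λ A → sgn A ℤ.* W (state (ends ∘ suc) A F)) _ (allSubsets m) ⟩
  alt (ends ∘ suc) W F ℤ.+ sumℤL (λ A → -1ℤ ℤ.* (sgn A ℤ.* W (state (ends ∘ suc) A U))) (allSubsets m)
    ≡⟨ cong (λ t → alt (ends ∘ suc) W F ℤ.+ t) 
         (trans (sumL-*ˡ -1ℤ (λ A → sgn A ℤ.* W (state (ends ∘ suc) A U)) (allSubsets m)) (ℤₚ.-1*i≡-i (alt (ends ∘ suc) W U))) ⟩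
  alt (ends ∘ suc) W F ℤ.- alt (ends ∘ suc) W U ∎
  where
  U = union F (proj₁ (ends zero)) (proj₂ (ends zero))

-- Deletion–contraction; a contraction either repeats the partition, so that the two terms cancel,
-- or merges two classes, which flips the sign.
alt-sign : ∀ {d m} (ends : Ends d m) W →
  (∀ F → 0ℤ ℤ.≤ -1ℤ ℤ.^ roots F ℤ.* W F) → ∀ F → 0ℤ ℤ.≤ -1ℤ ℤ.^ roots F ℤ.* alt ends W F
alt-sign {m = zero} ends W W-sign F = subst (0ℤ ℤ.≤_)
  (cong (-1ℤ ℤ.^ roots F ℤ.*_) (ℤS.solve 1 (λ w → w ℤS.:= ℤS.con 1ℤ ℤS.:* w ℤS.:+ ℤS.con 0ℤ) refl (W F))) (W-sign F)
alt-sign {m = suc m} ends W W-sign F with union-cases F (proj₁ (ends zero)) (proj₂ (ends zero))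
... | inj₁ (_ , U≡F) = ℤₚ.≤-reflexive (sym (begin
  -1ℤ ℤ.^ roots F ℤ.* alt ends W F  ≡⟨ cong (-1ℤ ℤ.^ roots F ℤ.*_) (alt-suc ends W F) ⟩
  -1ℤ ℤ.^ roots F ℤ.* (alt (ends ∘ suc) W F ℤ.- alt (ends ∘ suc) W (union F _ _))
    ≡⟨ cong (λ G → -1ℤ ℤ.^ roots F ℤ.* (alt (ends ∘ suc) W F ℤ.- alt (ends ∘ suc) W G)) U≡F ⟩
  -1ℤ ℤ.^ roots F ℤ.* (alt (ends ∘ suc) W F ℤ.- alt (ends ∘ suc) W F)
    ≡⟨ ℤS.solve 2 (λ s a → s ℤS.:* (a ℤS.:- a) ℤS.:= ℤS.con 0ℤ) refl (-1ℤ ℤ.^ roots F) (alt (ends ∘ suc) W F) ⟩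
  0ℤ ∎))
... | inj₂ (_ , suc-roots) = subst (0ℤ ℤ.≤_) eq
  (ℤₚ.+-mono-≤ (alt-sign (ends ∘ suc) W W-sign F) (alt-sign (ends ∘ suc) W W-sign U))
  where
  U = union F (proj₁ (ends zero)) (proj₂ (ends zero))
  s = -1ℤ ℤ.^ roots U
  eq : -1ℤ ℤ.^ roots F ℤ.* alt (ends ∘ suc) W F ℤ.+ s ℤ.* alt (ends ∘ suc) W U ≡ -1ℤ ℤ.^ roots F ℤ.* alt ends W F
  eq rewrite alt-suc ends W F | sym suc-roots =
    ℤS.solve 3 (λ s p q → (ℤS.con -1ℤ ℤS.:* s) ℤS.:* p ℤS.:+ s ℤS.:* q ℤS.:= (ℤS.con -1ℤ ℤS.:* s) ℤS.:* (p ℤS.:- q)) refl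
      s (alt (ends ∘ suc) W F) (alt (ends ∘ suc) W U)

-- Linear matroids over ℚ

sumℚ-cong : ∀ {N} {f g : Fin N → ℚ} → (∀ k → f k ≡ g k) → sumℚ f ≡ sumℚ g
sumℚ-cong {zero}  f≈g = refl
sumℚ-cong {suc N} f≈g = cong₂ ℚ._+_ (f≈g zero) (sumℚ-cong (f≈g ∘ suc))

sumℚ-zero : ∀ {N} {f : Fin N → ℚ} → (∀ k → f k ≡ 0ℚ) → sumℚ f ≡ 0ℚ
sumℚ-zero {zero}  f≈0 = refl
sumℚ-zero {suc N} f≈0 = cong₂ ℚ._+_ (f≈0 zero) (sumℚ-zero (f≈0 ∘ suc))

sumℚ-+* : ∀ {N} (q : ℚ) (f g : Fin N → ℚ) →
          sumℚ (λ k → f k ℚ.+ q ℚ.* g k) ≡ sumℚ f ℚ.+ q ℚ.* sumℚ g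
sumℚ-+* {zero}  q f g = ℚS.solve 1 (λ q → ℚS.con 0ℚ ℚS.:= ℚS.con 0ℚ ℚS.:+ q ℚS.:* ℚS.con 0ℚ) refl q
sumℚ-+* {suc N} q f g = trans (cong (λ t → f zero ℚ.+ q ℚ.* g zero ℚ.+ t) (sumℚ-+* q (f ∘ suc) (g ∘ suc)))
  (ℚS.solve 5 (λ q a b c d → (a ℚS.:+ q ℚS.:* b) ℚS.:+ (c ℚS.:+ q ℚS.:* d) ℚS.:= (a ℚS.:+ c) ℚS.:+ q ℚS.:* (b ℚS.:+ d)) refl
    q (f zero) (g zero) (sumℚ (f ∘ suc)) (sumℚ (g ∘ suc)))

sumℚ-single : ∀ {N} (e : Fin N) {f : Fin N → ℚ} → (∀ k → k ≢ e → f k ≡ 0ℚ) → sumℚ f ≡ f e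
sumℚ-single zero {f} off = trans (cong (f zero ℚ.+_) (sumℚ-zero (λ k → off (suc k) λ ()))) (ℚₚ.+-identityʳ _)
sumℚ-single (suc e) {f} off = trans
  (cong₂ ℚ._+_ (off zero λ ()) (sumℚ-single e (λ k k≢e → off (suc k) (k≢e ∘ Fin.suc-injective))))
  (ℚₚ.+-identityˡ _)

δ : ∀ {N} → Fin N → Fin N → ℚ
δ i x = if does (i ≟ x) then 1ℚ else 0ℚ

δ-diag : ∀ {N} (i : Fin N) → δ i i ≡ 1ℚ
δ-diag i rewrite dec-true (i ≟ i) refl = refl

δ-off : ∀ {N} {i x : Fin N} → x ≢ i → δ i x ≡ 0ℚ
δ-off {i = i} {x} x≢i rewrite dec-false (i ≟ x) (x≢i ∘ sym) = refl

dot : ∀ {N} → (Fin N → ℚ) → (Fin N → ℚ) → ℚ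
dot y v = sumℚ (λ x → y x ℚ.* v x)

dot-comm : ∀ {N} (y v : Fin N → ℚ) → dot y v ≡ dot v y
dot-comm y v = sumℚ-cong (λ x → ℚₚ.*-comm (y x) (v x))

dot-+* : ∀ {N} (q : ℚ) (y v w : Fin N → ℚ) → dot y (λ x → v x ℚ.+ q ℚ.* w x) ≡ dot y v ℚ.+ q ℚ.* dot y w
dot-+* q y v w = trans
  (sumℚ-cong λ x → ℚS.solve 4 (λ q y v w → y ℚS.:* (v ℚS.:+ q ℚS.:* w) ℚS.:= y ℚS.:* v ℚS.:+ q ℚS.:* (y ℚS.:* w)) refl
    q (y x) (v x) (w x))
  (sumℚ-+* q (λ x → y x ℚ.* v x) (λ x → y x ℚ.* w x))

dot-+*ˡ : ∀ {N} (q : ℚ) (y z v : Fin N → ℚ) → dot (λ x → y x ℚ.+ q ℚ.* z x) v ≡ dot y v ℚ.+ q ℚ.* dot z v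
dot-+*ˡ q y z v = trans (dot-comm _ v) (trans (dot-+* q v y z) (cong₂ (λ a b → a ℚ.+ q ℚ.* b) (dot-comm v y) (dot-comm v z)))

dot-δ : ∀ {N} (y : Fin N → ℚ) i → dot y (δ i) ≡ y i
dot-δ y i = trans
  (sumℚ-single i λ x x≢i → trans (cong (y x ℚ.*_) (δ-off x≢i)) (ℚₚ.*-zeroʳ (y x)))
  (trans (cong (y i ℚ.*_) (δ-diag i)) (ℚₚ.*-identityʳ _))

dot-zeroʳ : ∀ {N} (y : Fin N → ℚ) {v} → (∀ x → v x ≡ 0ℚ) → dot y v ≡ 0ℚ
dot-zeroʳ y v≈0 = sumℚ-zero (λ x → trans (cong (y x ℚ.*_) (v≈0 x)) (ℚₚ.*-zeroʳ (y x)))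

comb : ∀ {M N} → (Fin M → ℚ) → (Fin M → Fin N → ℚ) → Fin N → ℚ
comb c f x = sumℚ (λ k → c k ℚ.* f k x)

dot-comb : ∀ {M N} (y : Fin N → ℚ) (c : Fin M → ℚ) (f : Fin M → Fin N → ℚ) →
           dot y (comb c f) ≡ sumℚ (λ k → c k ℚ.* dot y (f k))
dot-comb {zero}  y c f = dot-zeroʳ y (λ x → refl)
dot-comb {suc M} y c f = begin
  dot y (λ x → c zero ℚ.* f zero x ℚ.+ comb (c ∘ suc) (f ∘ suc) x)
    ≡⟨ sumℚ-cong (λ x → cong (y x ℚ.*_) (ℚₚ.+-comm (c zero ℚ.* f zero x) _)) ⟩
  dot y (λ x → comb (c ∘ suc) (f ∘ suc) x ℚ.+ c zero ℚ.* f zero x)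
    ≡⟨ dot-+* (c zero) y _ (f zero) ⟩
  dot y (comb (c ∘ suc) (f ∘ suc)) ℚ.+ c zero ℚ.* dot y (f zero)
    ≡⟨ ℚₚ.+-comm _ (c zero ℚ.* dot y (f zero)) ⟩
  c zero ℚ.* dot y (f zero) ℚ.+ dot y (comb (c ∘ suc) (f ∘ suc))
    ≡⟨ cong (c zero ℚ.* dot y (f zero) ℚ.+_) (dot-comb y (c ∘ suc) (f ∘ suc)) ⟩
  sumℚ (λ k → c k ℚ.* dot y (f k)) ∎

inverse : ∀ {p} → p ≢ 0ℚ → ∃[ s ] s ℚ.* p ≡ 1ℚ
inverse {p} p≢0 = ℚ.1/_ p {{ℚ.≢-nonZero p≢0}} , ℚₚ.*-inverseˡ p {{ℚ.≢-nonZero p≢0}}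

*-cancel-0 : ∀ {p q} → q ≢ 0ℚ → p ℚ.* q ≡ 0ℚ → p ≡ 0ℚ
*-cancel-0 {p} {q} q≢0 pq≡0 with inverse q≢0
... | s , sq≡1 = begin
  p            ≡⟨ ℚₚ.*-identityʳ p ⟨
  p ℚ.* 1ℚ       ≡⟨ cong (p ℚ.*_) sq≡1 ⟨
  p ℚ.* (s ℚ.* q)  ≡⟨ ℚS.solve 3 (λ p s q → p ℚS.:* (s ℚS.:* q) ℚS.:= s ℚS.:* (p ℚS.:* q)) refl p s q ⟩
  s ℚ.* (p ℚ.* q)  ≡⟨ cong (s ℚ.*_) pq≡0 ⟩
  s ℚ.* 0ℚ       ≡⟨ ℚₚ.*-zeroʳ s ⟩
  0ℚ           ∎

span-or-separate : ∀ {M N} (f : Fin M → Fin N → ℚ) (v : Fin N → ℚ) →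
  (∃[ c ] ∀ x → comb c f x ≡ v x) ⊎ (∃[ y ] (∀ k → dot y (f k) ≡ 0ℚ) × dot y v ≢ 0ℚ)
span-or-separate {zero} f v with Fin.any? (λ x → ¬? (v x ℚₚ.≟ 0ℚ))
... | yes (x , vx≢0) = inj₂ (δ x , (λ ()) , λ eq → vx≢0 (trans (sym (dot-δ v x)) (trans (dot-comm v (δ x)) eq)))
... | no  v≈0 = inj₁ ((λ ()) , λ x → sym (decidable-stable (v x ℚₚ.≟ 0ℚ) (λ ne → v≈0 (x , ne))))
span-or-separate {suc M} f v with span-or-separate (f ∘ suc) (f zero)
... | inj₁ (c , c≈) = case-v (span-or-separate (f ∘ suc) v)
  where
  case-v : _ → _
  case-v (inj₁ (c′ , c′≈)) = inj₁ ((λ { zero → 0ℚ ; (suc k) → c′ k }) , λ x →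
    trans (cong (ℚ._+ comb c′ (f ∘ suc) x) (ℚₚ.*-zeroˡ (f zero x))) (trans (ℚₚ.+-identityˡ (comb c′ (f ∘ suc) x)) (c′≈ x)))
  case-v (inj₂ (y , kill , ne)) = inj₂ (y , kill′ , ne)
    where
    kill′ : ∀ k → dot y (f k) ≡ 0ℚ
    kill′ (suc k) = kill k
    kill′ zero = trans (sumℚ-cong (λ x → cong (y x ℚ.*_) (sym (c≈ x))))
      (trans (dot-comb y c (f ∘ suc)) (dot-zeroʳ c kill))
... | inj₂ (y , kill , ya≢0) = case-v′ (span-or-separate (f ∘ suc) v′)
  where
  s  = proj₁ (inverse ya≢0)
  a  = f zero
  α  = dot y a
  -- v′ is v projected along a onto the hyperplane y = 0.
  t  = ℚ.- (s ℚ.* dot y v)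
  v′ = λ x → v x ℚ.+ t ℚ.* a x
  case-v′ : _ → _
  case-v′ (inj₁ (c , c≈)) = inj₁ ((λ { zero → s ℚ.* dot y v ; (suc k) → c k }) , λ x → begin
    s ℚ.* dot y v ℚ.* a x ℚ.+ comb c (f ∘ suc) x  ≡⟨ cong (s ℚ.* dot y v ℚ.* a x ℚ.+_) (c≈ x) ⟩
    s ℚ.* dot y v ℚ.* a x ℚ.+ v′ x
      ≡⟨ ℚS.solve 3 (λ t a v → t ℚS.:* a ℚS.:+ (v ℚS.:+ (ℚS.:- t) ℚS.:* a) ℚS.:= v) refl (s ℚ.* dot y v) (a x) (v x) ⟩
    v x ∎)
  case-v′ (inj₂ (z , zkill , zv′≢0)) = inj₂ (w , wkill , wv≢0)
    where
    u = ℚ.- (s ℚ.* dot z a)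
    -- The multiple of `y` is chosen so that `w` vanishes on `a`; as `y` kills the remaining
    -- vectors, `w` still kills them.
    w = λ x → z x ℚ.+ u ℚ.* y x
    wkill : ∀ k → dot w (f k) ≡ 0ℚ
    wkill zero = begin
      dot w a                               ≡⟨ dot-+*ˡ u z y a ⟩
      dot z a ℚ.+ (ℚ.- (s ℚ.* dot z a)) ℚ.* α
        ≡⟨ ℚS.solve 3 (λ s q α → q ℚS.:+ (ℚS.:- (s ℚS.:* q)) ℚS.:* α ℚS.:= q ℚS.:* (ℚS.con 1ℚ ℚS.:- s ℚS.:* α)) refl s (dot z a) α ⟩
      dot z a ℚ.* (1ℚ ℚ.- s ℚ.* α)                ≡⟨ cong (λ t → dot z a ℚ.* (1ℚ ℚ.- t)) (proj₂ (inverse ya≢0)) ⟩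
      dot z a ℚ.* 0ℚ                          ≡⟨ ℚₚ.*-zeroʳ (dot z a) ⟩
      0ℚ                                    ∎
    wkill (suc k) = trans (dot-+*ˡ u z y (f (suc k)))
      (trans (cong₂ (λ p q → p ℚ.+ u ℚ.* q) (zkill k) (kill k)) (trans (ℚₚ.+-identityˡ (u ℚ.* 0ℚ)) (ℚₚ.*-zeroʳ u)))
    -- Correcting `z` along `y` and correcting `v` along `a` give the same number, so `w` takes on
    -- `v` the value of `z` on `v′`.
    wv≢0 : dot w v ≢ 0ℚ
    wv≢0 eq = zv′≢0 (begin
      dot z v′                            ≡⟨ dot-+* t z v a ⟩
      dot z v ℚ.+ (ℚ.- (s ℚ.* dot y v)) ℚ.* dot z a
        ≡⟨ ℚS.solve 4 (λ s p q r → p ℚS.:+ (ℚS.:- (s ℚS.:* q)) ℚS.:* r ℚS.:= p ℚS.:+ (ℚS.:- (s ℚS.:* r)) ℚS.:* q) refl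
             s (dot z v) (dot y v) (dot z a) ⟩
      dot z v ℚ.+ (ℚ.- (s ℚ.* dot z a)) ℚ.* dot y v  ≡⟨ dot-+*ˡ u z y v ⟨
      dot w v                             ≡⟨ eq ⟩
      0ℚ                                  ∎)

-- Subsets with one element inserted or deleted

module _ {M : ℕ} where

  ⊆-insert : ∀ {A : Subset M} e → A ⊆ A [ e ]≔ inside
  ⊆-insert {A} e {k} k∈A with k ≟ e
  ... | yes refl = []≔-updates A e
  ... | no  k≢e  = []≔-minimal A k e k≢e k∈A

  ∈-[]≔⁻ : ∀ {A : Subset M} {e k s} → k ≢ e → k ∈ A [ e ]≔ s → k ∈ A
  ∈-[]≔⁻ {A} {e} {k} {s} k≢e k∈ = subst (k ∈_)
    (trans ([]≔-idempotent A e) ([]≔-lookup A e))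
    ([]≔-minimal (A [ e ]≔ s) k e k≢e k∈)

  ∉-delete : ∀ (A : Subset M) e → e ∉ A [ e ]≔ outside
  ∉-delete A e e∈ with []=-injective e∈ ([]≔-updates A e)
  ... | ()

  delete-⊆ : ∀ {A T : Subset M} {e} → T ⊆ A [ e ]≔ inside → T [ e ]≔ outside ⊆ A
  delete-⊆ {A} {T} {e} T⊆ {k} k∈ with k ≟ e
  ... | yes refl = contradiction k∈ (∉-delete T e)
  ... | no  k≢e  = ∈-[]≔⁻ k≢e (T⊆ (∈-[]≔⁻ k≢e k∈))

  insert-⊆ : ∀ {A T : Subset M} {e} → T ⊆ A → e ∈ A → T [ e ]≔ inside ⊆ A
  insert-⊆ {A} {T} {e} T⊆A e∈A {k} k∈ with k ≟ e
  ... | yes refl = e∈A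
  ... | no  k≢e  = T⊆A (∈-[]≔⁻ k≢e k∈)

  insert-delete : ∀ {T : Subset M} {e} → e ∈ T → (T [ e ]≔ outside) [ e ]≔ inside ≡ T
  insert-delete {T} {e} e∈T = trans ([]≔-idempotent T e)
    (trans (cong (T [ e ]≔_) (sym ([]=⇒lookup e∈T))) ([]≔-lookup T e))

∣insert∣ : ∀ {M} (A : Subset M) {e} → e ∉ A → ∣ A [ e ]≔ inside ∣ ≡ suc ∣ A ∣
∣insert∣ (true  ∷ A) {zero}  e∉ = contradiction here e∉
∣insert∣ (false ∷ A) {zero}  e∉ = refl
∣insert∣ (true  ∷ A) {suc e} e∉ = cong suc (∣insert∣ A (e∉ ∘ there))
∣insert∣ (false ∷ A) {suc e} e∉ = ∣insert∣ A (e∉ ∘ there)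

∣delete∣ : ∀ {M} {T : Subset M} {e} → e ∈ T → suc ∣ T [ e ]≔ outside ∣ ≡ ∣ T ∣
∣delete∣ {T = T} {e} e∈T =
  trans (sym (∣insert∣ (T [ e ]≔ outside) (∉-delete T e))) (cong ∣_∣ (insert-delete e∈T))

module LinearMatroid {M D : ℕ} (f : Fin M → Fin D → ℚ) where

  -- For `f` equal to `vec` this is `Independent` by definition, so a proof of `IsRankFn` can be
  -- handed to `Rank` as it is.
  Indep : Subset M → Set
  Indep S = ∀ (c : Fin M → ℚ) → (∀ k → k ∉ S → c k ≡ 0ℚ) → (∀ x → comb c f x ≡ 0ℚ) → ∀ k → c k ≡ 0ℚ

  Kills : Subset M → (Fin D → ℚ) → Set
  Kills A y = ∀ k → k ∈ A → dot y (f k) ≡ 0ℚ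

  indep-⊆ : ∀ {S T} → S ⊆ T → Indep T → Indep S
  indep-⊆ S⊆T indep c supp = indep c (λ k k∉T → supp k (k∉T ∘ S⊆T))

  -- Applying `y` to a vanishing combination leaves only the term of `e`, so that coefficient is
  -- zero and the others fall under the independence of `T`.
  indep-insert : ∀ {T e} y → Indep T → Kills T y → dot y (f e) ≢ 0ℚ → Indep (T [ e ]≔ inside)
  indep-insert {T} {e} y indep kills ye≢0 c supp comb≡0 = indep c supp′ comb≡0
    where
    vanish : ∀ k → k ≢ e → c k ℚ.* dot y (f k) ≡ 0ℚ
    vanish k k≢e with k ∈? T
    ... | yes k∈T = trans (cong (c k ℚ.*_) (kills k k∈T)) (ℚₚ.*-zeroʳ (c k))
    ... | no  k∉T = trans (cong (ℚ._* dot y (f k)) (supp k (k∉T ∘ ∈-[]≔⁻ k≢e))) (ℚₚ.*-zeroˡ (dot y (f k)))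
    ce≡0 : c e ≡ 0ℚ
    ce≡0 = *-cancel-0 ye≢0 (begin
      c e ℚ.* dot y (f e)               ≡⟨ sumℚ-single e vanish ⟨
      sumℚ (λ k → c k ℚ.* dot y (f k))  ≡⟨ dot-comb y c f ⟨
      dot y (comb c f)                ≡⟨ dot-zeroʳ y comb≡0 ⟩
      0ℚ                              ∎)
    supp′ : ∀ k → k ∉ T → c k ≡ 0ℚ
    supp′ k k∉T with k ≟ e
    ... | yes refl = ce≡0
    ... | no  k≢e  = supp k (k∉T ∘ ∈-[]≔⁻ k≢e)

  χ : Subset M → Fin M → ℚ
  χ T k = if does (k ∈? T) then 1ℚ else 0ℚ

  -- If no functional separated `f e` from `T`, then `f e` would be a combination of `T`, a
  -- dependency with coefficient -1 at `e`.
  indep-separate : ∀ {T e} → e ∉ T → Indep (T [ e ]≔ inside) → ∃[ y ] Kills T y × dot y (f e) ≢ 0ℚ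
  indep-separate {T} {e} e∉T indep with span-or-separate (λ k x → χ T k ℚ.* f k x) (f e)
  ... | inj₂ (y , kill , ne) = y , kill′ , ne
    where
    kill′ : Kills T y
    kill′ k k∈T with kill k
    ... | eq rewrite dec-true (k ∈? T) k∈T =
      trans (sumℚ-cong (λ x → cong (y x ℚ.*_) (sym (ℚₚ.*-identityˡ (f k x))))) eq
  ... | inj₁ (c , c≈) = contradiction (trans (sym c′e) (indep c′ supp c′≈ e)) λ ()
    where
    μ = χ T
    c′ : Fin M → ℚ
    c′ k = c k ℚ.* μ k ℚ.+ (ℚ.- 1ℚ) ℚ.* δ e k
    μ-off : ∀ {k} → k ∉ T → μ k ≡ 0ℚ
    μ-off {k} k∉T rewrite dec-false (k ∈? T) k∉T = refl
    c′e : c′ e ≡ ℚ.- 1ℚ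
    c′e = trans (cong₂ (λ p q → c e ℚ.* p ℚ.+ (ℚ.- 1ℚ) ℚ.* q) (μ-off e∉T) (δ-diag e)) (cong (ℚ._+ (ℚ.- 1ℚ)) (ℚₚ.*-zeroʳ (c e)))
    supp : ∀ k → k ∉ T [ e ]≔ inside → c′ k ≡ 0ℚ
    supp k k∉ = trans
      (cong₂ (λ p q → c k ℚ.* p ℚ.+ (ℚ.- 1ℚ) ℚ.* q) (μ-off (k∉ ∘ ⊆-insert e)) (δ-off {i = e} {k} λ { refl → k∉ ([]≔-updates T e) }))
      (cong (ℚ._+ 0ℚ) (ℚₚ.*-zeroʳ (c k)))
    c′≈ : ∀ x → comb c′ f x ≡ 0ℚ
    c′≈ x = begin
      comb c′ f x
        ≡⟨ sumℚ-cong (λ k → ℚS.solve 4 (λ c μ d f → (c ℚS.:* μ ℚS.:+ ℚS.con (ℚ.- 1ℚ) ℚS.:* d) ℚS.:* f ℚS.:=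
                                    c ℚS.:* (μ ℚS.:* f) ℚS.:+ ℚS.con (ℚ.- 1ℚ) ℚS.:* (f ℚS.:* d)) refl
             (c k) (μ k) (δ e k) (f k x)) ⟩
      sumℚ (λ k → c k ℚ.* (μ k ℚ.* f k x) ℚ.+ (ℚ.- 1ℚ) ℚ.* (f k x ℚ.* δ e k))
        ≡⟨ sumℚ-+* (ℚ.- 1ℚ) (λ k → c k ℚ.* (μ k ℚ.* f k x)) (λ k → f k x ℚ.* δ e k) ⟩
      comb c (λ k x → μ k ℚ.* f k x) x ℚ.+ (ℚ.- 1ℚ) ℚ.* dot (λ k → f k x) (δ e)
        ≡⟨ cong₂ (λ p q → p ℚ.+ (ℚ.- 1ℚ) ℚ.* q) (c≈ x) (dot-δ (λ k → f k x) e) ⟩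
      f e x ℚ.+ (ℚ.- 1ℚ) ℚ.* f e x
        ≡⟨ ℚS.solve 1 (λ p → p ℚS.:+ ℚS.con (ℚ.- 1ℚ) ℚS.:* p ℚS.:= ℚS.con 0ℚ) refl (f e x) ⟩
      0ℚ ∎

  module Rank (r : Subset M → ℕ)
    (isRank : ∀ S → (∃[ T ] (T ⊆ S × Indep T × ∣ T ∣ ≡ r S)) × (∀ T → T ⊆ S → Indep T → ∣ T ∣ ℕ.≤ r S)) where

    -- A basis of `A` stays independent after adding `e`, and deleting `e` from an independent set
    -- costs one element.
    rank-grow : ∀ {A e} y → Kills A y → dot y (f e) ≢ 0ℚ → r (A [ e ]≔ inside) ≡ suc (r A)
    rank-grow {A} {e} y kills ye≢0 = ℕₚ.≤-antisym upper lower
      where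
      lower : suc (r A) ℕ.≤ r (A [ e ]≔ inside)
      lower with proj₁ (isRank A)
      ... | T , T⊆A , indep , ∣T∣≡ = subst (ℕ._≤ _)
        (trans (∣insert∣ T (λ e∈T → ye≢0 (kills e (T⊆A e∈T)))) (cong suc ∣T∣≡))
        (proj₂ (isRank (A [ e ]≔ inside)) (T [ e ]≔ inside)
          (insert-⊆ (⊆-insert e ∘ T⊆A) ([]≔-updates A e))
          (indep-insert y indep (λ k → kills k ∘ T⊆A) ye≢0))
      upper : r (A [ e ]≔ inside) ℕ.≤ suc (r A)
      upper with proj₁ (isRank (A [ e ]≔ inside))
      ... | T , T⊆ , indep , ∣T∣≡ with e ∈? T
      ...   | yes e∈T = subst (ℕ._≤ suc (r A)) (trans (∣delete∣ e∈T) ∣T∣≡)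
                (ℕ.s≤s (proj₂ (isRank A) (T [ e ]≔ outside) (delete-⊆ T⊆)
                  (indep-⊆ (subst (T [ e ]≔ outside ⊆_) (insert-delete e∈T) (⊆-insert e)) indep)))
      ...   | no  e∉T = subst (ℕ._≤ suc (r A)) ∣T∣≡
                (ℕₚ.m≤n⇒m≤1+n (proj₂ (isRank A) T (λ {k} k∈T → ∈-[]≔⁻ (λ { refl → e∉T k∈T }) (T⊆ k∈T)) indep))

    -- The hypothesis is the dual form of `f e` lying in the span of `A`, the form in which
    -- potentials deliver it.
    rank-stay : ∀ {A e} → (∀ y → Kills A y → dot y (f e) ≡ 0ℚ) → r (A [ e ]≔ inside) ≡ r A
    rank-stay {A} {e} spanned = ℕₚ.≤-antisym upper lower
      where
      lower : r A ℕ.≤ r (A [ e ]≔ inside)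
      lower with proj₁ (isRank A)
      ... | T , T⊆A , indep , ∣T∣≡ = subst (ℕ._≤ _) ∣T∣≡ (proj₂ (isRank (A [ e ]≔ inside)) T (⊆-insert e ∘ T⊆A) indep)
      upper : r (A [ e ]≔ inside) ℕ.≤ r A
      upper with proj₁ (isRank (A [ e ]≔ inside))
      ... | T , T⊆ , indep , ∣T∣≡ with e ∈? T
      ...   | no  e∉T = subst (ℕ._≤ r A) ∣T∣≡
                (proj₂ (isRank A) T (λ {k} k∈T → ∈-[]≔⁻ (λ { refl → e∉T k∈T }) (T⊆ k∈T)) indep)
      -- Exchange e for an element of A outside the span of T ∖ e.
      ...   | yes e∈T with indep-separate (∉-delete T e) (subst Indep (sym (insert-delete e∈T)) indep)
      ...     | y , kills , ye≢0 with Fin.any? (λ a → (a ∈? A) ×-dec ¬? (dot y (f a) ℚₚ.≟ 0ℚ))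
      ...       | yes (a , a∈A , ya≢0) = subst (ℕ._≤ r A)
                    (trans (∣insert∣ (T [ e ]≔ outside) (λ a∈ → ya≢0 (kills a a∈))) (trans (∣delete∣ e∈T) ∣T∣≡))
                    (proj₂ (isRank A) ((T [ e ]≔ outside) [ a ]≔ inside)
                      (insert-⊆ (delete-⊆ T⊆) a∈A)
                      (indep-insert y (indep-⊆ (subst (T [ e ]≔ outside ⊆_) (insert-delete e∈T) (⊆-insert e)) indep) kills ya≢0))
      ...       | no none = contradiction
                    (spanned y λ a a∈A → decidable-stable (dot y (f a) ℚₚ.≟ 0ℚ) (λ ne → none (a , a∈A , ne))) ye≢0

-- Polynomials and the chromatic polynomial

-- Coefficients run from the top degree down and include their signs, so `altPoly` is an instance by
-- definition.
poly : ℕ → (ℕ → ℤ) → ℤ → ℤ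
poly D c x = sumℤ {suc D} (λ i → c (toℕ i) ℤ.* x ℤ.^ (D ∸ toℕ i))

-- The recursion of the sum splits off the leading term; the divisibility argument needs the
-- constant term split off instead.
horner : ∀ D c x → poly (suc D) c x ≡ x ℤ.* poly D c x ℤ.+ c (suc D)
horner zero    c x = ℤS.solve 3 (λ c₀ c₁ x →
  c₀ ℤS.:* (x ℤS.:* ℤS.con 1ℤ) ℤS.:+ (c₁ ℤS.:* ℤS.con 1ℤ ℤS.:+ ℤS.con 0ℤ) ℤS.:=
  x ℤS.:* (c₀ ℤS.:* ℤS.con 1ℤ ℤS.:+ ℤS.con 0ℤ) ℤS.:+ c₁) refl (c 0) (c 1) x
horner (suc D) c x = trans (cong (λ t → c 0 ℤ.* x ℤ.^ suc (suc D) ℤ.+ t) (horner D (c ∘ suc) x))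
  (ℤS.solve 5 (λ c₀ x xᴰ p c₂ → c₀ ℤS.:* (x ℤS.:* xᴰ) ℤS.:+ (x ℤS.:* p ℤS.:+ c₂) ℤS.:=
                            x ℤS.:* (c₀ ℤS.:* xᴰ ℤS.:+ p) ℤS.:+ c₂) refl
    (c 0) x (x ℤ.^ suc D) (poly D (c ∘ suc) x) (c (suc (suc D))))

poly-+ : ∀ D c c′ x → poly D (λ i → c i ℤ.+ c′ i) x ≡ poly D c x ℤ.+ poly D c′ x
poly-+ zero    c c′ x = ℤS.solve 2 (λ a b → (a ℤS.:+ b) ℤS.:* ℤS.con 1ℤ ℤS.:+ ℤS.con 0ℤ ℤS.:=
  (a ℤS.:* ℤS.con 1ℤ ℤS.:+ ℤS.con 0ℤ) ℤS.:+ (b ℤS.:* ℤS.con 1ℤ ℤS.:+ ℤS.con 0ℤ)) refl (c 0) (c′ 0)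
poly-+ (suc D) c c′ x = trans (cong (λ t → (c 0 ℤ.+ c′ 0) ℤ.* x ℤ.^ suc D ℤ.+ t) (poly-+ D (c ∘ suc) (c′ ∘ suc) x))
  (ℤS.solve 5 (λ a b y p q → (a ℤS.:+ b) ℤS.:* y ℤS.:+ (p ℤS.:+ q) ℤS.:= (a ℤS.:* y ℤS.:+ p) ℤS.:+ (b ℤS.:* y ℤS.:+ q)) refl
    (c 0) (c′ 0) (x ℤ.^ suc D) (poly D (c ∘ suc) x) (poly D (c′ ∘ suc) x))

poly-*ˡ : ∀ D q c x → poly D (λ i → q ℤ.* c i) x ≡ q ℤ.* poly D c x
poly-*ˡ zero    q c x = ℤS.solve 2 (λ q a → (q ℤS.:* a) ℤS.:* ℤS.con 1ℤ ℤS.:+ ℤS.con 0ℤ ℤS.:=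
  q ℤS.:* (a ℤS.:* ℤS.con 1ℤ ℤS.:+ ℤS.con 0ℤ)) refl q (c 0)
poly-*ˡ (suc D) q c x = trans (cong (λ t → (q ℤ.* c 0) ℤ.* x ℤ.^ suc D ℤ.+ t) (poly-*ˡ D q (c ∘ suc) x))
  (ℤS.solve 4 (λ q a y p → (q ℤS.:* a) ℤS.:* y ℤS.:+ q ℤS.:* p ℤS.:= q ℤS.:* (a ℤS.:* y ℤS.:+ p)) refl
    q (c 0) (x ℤ.^ suc D) (poly D (c ∘ suc) x))

poly-0 : ∀ D x → poly D (λ _ → 0ℤ) x ≡ 0ℤ
poly-0 D x = trans (poly-*ˡ D 0ℤ (λ _ → 0ℤ) x) (ℤₚ.*-zeroˡ (poly D (λ _ → 0ℤ) x))

poly-sumL : ∀ {X : Set} D (f : X → ℕ → ℤ) xs x →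
  poly D (λ i → sumℤL (λ a → f a i) xs) x ≡ sumℤL (λ a → poly D (f a) x) xs
poly-sumL D f []       x = poly-0 D x
poly-sumL D f (a ∷ xs) x = trans (poly-+ D (f a) (λ i → sumℤL (λ a → f a i) xs) x)
  (cong (λ t → poly D (f a) x ℤ.+ t) (poly-sumL D f xs x))

poly-monomial : ∀ {t D} → t ℕ.≤ D → ∀ x → poly D (λ i → ι (t ℕ.≟ i)) x ≡ x ℤ.^ (D ∸ t)
poly-monomial {zero} {zero}  t≤D x = refl
poly-monomial {zero} {suc D} t≤D x = trans (cong (λ t → 1ℤ ℤ.* x ℤ.^ suc D ℤ.+ t) (poly-0 D x))
  (trans (ℤₚ.+-identityʳ _) (ℤₚ.*-identityˡ _))
poly-monomial {suc t} {suc D} (ℕ.s≤s t≤D) x = trans (ℤₚ.+-identityˡ _) (poly-monomial t≤D x)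

-- The constant term is divisible by every x, hence vanishes.
constant-zero : ∀ D c → (∀ x → poly D c (+ suc (suc x)) ≡ 0ℤ) → c D ≡ 0ℤ
constant-zero zero    c vanish = trans
  (ℤS.solve 1 (λ c → c ℤS.:= c ℤS.:* ℤS.con 1ℤ ℤS.:+ ℤS.con 0ℤ) refl (c 0)) (vanish 0)
constant-zero (suc D) c vanish = case-q ℤ.∣ q ∣ refl
  where
  -- The evaluation point `suc x` is the absolute value of the constant term plus 2, so any nonzero
  -- multiple of it is too large.
  x = suc ℤ.∣ c (suc D) ∣
  p = poly D c (+ suc x)
  q = ℤ.- p
  c≡ : c (suc D) ≡ q ℤ.* + suc x
  c≡ = begin
    c (suc D)
      ≡⟨ ℤS.solve 3 (λ x p c → c ℤS.:= (x ℤS.:* p ℤS.:+ c) ℤS.:+ (ℤS.:- p) ℤS.:* x) refl (+ suc x) p (c (suc D)) ⟩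
    (+ suc x ℤ.* p ℤ.+ c (suc D)) ℤ.+ q ℤ.* + suc x
      ≡⟨ cong (λ t → t ℤ.+ q ℤ.* + suc x) (trans (sym (horner D c (+ suc x))) (vanish _)) ⟩
    0ℤ ℤ.+ q ℤ.* + suc x  ≡⟨ ℤₚ.+-identityˡ _ ⟩
    q ℤ.* + suc x         ∎
  case-q : ∀ k → ℤ.∣ q ∣ ≡ k → c (suc D) ≡ 0ℤ
  case-q zero    eq = trans c≡ (trans (cong (λ t → t ℤ.* + suc x) (ℤₚ.∣i∣≡0⇒i≡0 {q} eq)) (ℤₚ.*-zeroˡ (+ suc x)))
  case-q (suc k) eq = contradiction
    (trans (cong ℤ.∣_∣ c≡) (trans (ℤₚ.abs-* q (+ suc x)) (cong (ℕ._* suc x) eq)))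
    (ℕₚ.<⇒≢ (ℕₚ.≤-trans (ℕₚ.n≤1+n _) (ℕₚ.m≤m+n (suc x) (k ℕ.* suc x))))

-- Once the constant term vanishes, the nonzero evaluation point can be divided out, leaving a
-- polynomial of lower degree.
poly-zero : ∀ D c → (∀ x → poly D c (+ suc (suc x)) ≡ 0ℤ) → ∀ {i} → i ℕ.≤ D → c i ≡ 0ℤ
poly-zero zero    c vanish ℕ.z≤n = constant-zero 0 c vanish
poly-zero (suc D) c vanish i≤ with ℕₚ.m≤n⇒m<n∨m≡n i≤
... | inj₂ refl = constant-zero (suc D) c vanish
... | inj₁ (ℕ.s≤s i≤D) = poly-zero D c vanish′ i≤D
  where
  vanish′ : ∀ x → poly D c (+ suc (suc x)) ≡ 0ℤ
  vanish′ x with ℤₚ.i*j≡0⇒i≡0∨j≡0 (+ suc (suc x)) (begin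
      + suc (suc x) ℤ.* p                ≡⟨ ℤₚ.+-identityʳ _ ⟨
      + suc (suc x) ℤ.* p ℤ.+ 0ℤ         ≡⟨ cong (λ t → + suc (suc x) ℤ.* p ℤ.+ t) (constant-zero (suc D) c vanish) ⟨
      + suc (suc x) ℤ.* p ℤ.+ c (suc D)  ≡⟨ horner D c (+ suc (suc x)) ⟨
      poly (suc D) c (+ suc (suc x))     ≡⟨ vanish x ⟩
      0ℤ                                 ∎)
    where p = poly D c (+ suc (suc x))
  ... | inj₂ p≡0 = p≡0

poly-unique : ∀ D c c′ → (∀ x → poly D c (+ suc (suc x)) ≡ poly D c′ (+ suc (suc x))) → ∀ {i} → i ℕ.≤ D → c i ≡ c′ i
poly-unique D c c′ eq {i} i≤D = ℤₚ.i-j≡0⇒i≡j (c i) (c′ i)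
  (trans (cong (λ t → c i ℤ.+ t) (sym (ℤₚ.-1*i≡-i (c′ i)))) (poly-zero D (λ i → c i ℤ.+ -1ℤ ℤ.* c′ i) vanish i≤D))
  where
  vanish : ∀ x → poly D (λ i → c i ℤ.+ -1ℤ ℤ.* c′ i) (+ suc (suc x)) ≡ 0ℤ
  vanish x = begin
    poly D (λ i → c i ℤ.+ -1ℤ ℤ.* c′ i) y  ≡⟨ poly-+ D c (λ i → -1ℤ ℤ.* c′ i) y ⟩
    poly D c y ℤ.+ poly D (λ i → -1ℤ ℤ.* c′ i) y  ≡⟨ cong₂ ℤ._+_ (eq x) (poly-*ˡ D -1ℤ c′ y) ⟩
    poly D c′ y ℤ.+ -1ℤ ℤ.* poly D c′ y  ≡⟨ ℤS.solve 1 (λ p → p ℤS.:+ ℤS.con -1ℤ ℤS.:* p ℤS.:= ℤS.con 0ℤ) refl (poly D c′ y) ⟩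
    0ℤ ∎
    where y = + suc (suc x)

ρ : ∀ {d} → Forest d → ℕ
ρ {d} F = d ∸ roots F

-- Collects powers by rank. A term of rank above `D` would get a wrong exponent from truncated
-- subtraction, so its weight has to vanish.
poly-alt : ∀ {d m} (ends : Ends d m) (w : Forest d → ℤ) F D x →
  (∀ A → w (state ends A F) ≡ 0ℤ ⊎ ρ (state ends A F) ℕ.≤ D) →
  poly D (λ i → alt ends (λ G → w G ℤ.* ι (ρ G ℕ.≟ i)) F) x ≡ alt ends (λ G → w G ℤ.* x ℤ.^ (D ∸ ρ G)) F
poly-alt {m = m} ends w F D x small = trans
  (poly-sumL D (λ A i → sgn A ℤ.* (w (state ends A F) ℤ.* ι (ρ (state ends A F) ℕ.≟ i))) (allSubsets m) x)
  (sumL-cong (λ A → trans (poly-*ˡ D (sgn A) (λ i → w (G A) ℤ.* ι (ρ (G A) ℕ.≟ i)) x) (cong (λ t → sgn A ℤ.* t)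
    (trans (poly-*ˡ D (w (G A)) (λ i → ι (ρ (G A) ℕ.≟ i)) x) (term A)))) (allSubsets m))
  where
  G : Subset m → _
  G A = state ends A F
  term : ∀ A → w (G A) ℤ.* poly D (λ i → ι (ρ (G A) ℕ.≟ i)) x ≡ w (G A) ℤ.* x ℤ.^ (D ∸ ρ (G A))
  term A with small A
  ... | inj₁ w≡0 rewrite w≡0 =
    trans (ℤₚ.*-zeroˡ (poly D (λ i → ι (ρ (G A) ℕ.≟ i)) x)) (sym (ℤₚ.*-zeroˡ (x ℤ.^ (D ∸ ρ (G A)))))
  ... | inj₂ ρ≤D = cong (λ t → w (G A) ℤ.* t) (poly-monomial ρ≤D x)

-- Agrees with `properᵇ` by definition, but on a bare family of edges, so that induction can drop
-- one.
properly : ∀ {k d m} → Ends d m → Vec (Fin k) d → Bool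
properly {m = m} ends c = foldr _∧_ true
  (map (λ e → not (does (lookup c (proj₁ (ends e)) ≟ lookup c (proj₂ (ends e))))) (allFin m))

properly-suc : ∀ {k d m} (ends : Ends d (suc m)) (c : Vec (Fin k) d) →
  (if properly ends c then 1ℤ else 0ℤ) ≡
  (1ℤ ℤ.- ι (Mono? c (proj₁ (ends zero)) (proj₂ (ends zero)))) ℤ.* (if properly (ends ∘ suc) c then 1ℤ else 0ℤ)
properly-suc {m = m} ends c
  rewrite map-tabulate {n = m} suc (λ e → not (does (lookup c (proj₁ (ends e)) ≟ lookup c (proj₂ (ends e)))))
        | map-tabulate {n = m} id (λ e → not (does (lookup c (proj₁ (ends (suc e))) ≟ lookup c (proj₂ (ends (suc e))))))
  with does (lookup c (proj₁ (ends zero)) ≟ lookup c (proj₂ (ends zero)))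
... | true  = refl
... | false = sym (ℤₚ.*-identityˡ _)

respects-union : ∀ {k d} (F : Forest d) u v (c : Vec (Fin k) d) →
  respects (union F u v) c ≡ respects F c ℤ.* ι (Mono? c u v)
respects-union F u v c = trans
  (ι-cong (Resp? (union F u v) (Mono? c)) (Resp? F (Mono? c) ×-dec Mono? c u v)
    (Resp-union⁻ (Mono-eq c) F u v) (λ (rF , r) → Resp-union⁺ (Mono-eq c) F u v rF r))
  (ι-× (Resp? F (Mono? c)) (Mono? c u v))

-- Inclusion-exclusion for a fixed colouring: each edge contributes the factor 1 minus the indicator
-- of being monochromatic.
alt-respects : ∀ {k d m} (ends : Ends d m) F (c : Vec (Fin k) d) →
  alt ends (λ G → respects G c) F ≡ respects F c ℤ.* (if properly ends c then 1ℤ else 0ℤ)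
alt-respects {m = zero}  ends F c = ℤS.solve 1 (λ p → ℤS.con 1ℤ ℤS.:* p ℤS.:+ ℤS.con 0ℤ ℤS.:= p ℤS.:* ℤS.con 1ℤ) refl (respects F c)
alt-respects {m = suc m} ends F c = begin
  alt ends (λ G → respects G c) F
    ≡⟨ alt-suc ends (λ G → respects G c) F ⟩
  alt (ends ∘ suc) (λ G → respects G c) F ℤ.- alt (ends ∘ suc) (λ G → respects G c) (union F u v)
    ≡⟨ cong₂ ℤ._-_ (alt-respects (ends ∘ suc) F c)
         (trans (alt-respects (ends ∘ suc) (union F u v) c) (cong (λ t → t ℤ.* P) (respects-union F u v c))) ⟩
  respects F c ℤ.* P ℤ.- respects F c ℤ.* ι (Mono? c u v) ℤ.* P
    ≡⟨ ℤS.solve 3 (λ r p e → r ℤS.:* p ℤS.:- (r ℤS.:* e) ℤS.:* p ℤS.:= r ℤS.:* ((ℤS.con 1ℤ ℤS.:- e) ℤS.:* p)) refl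
         (respects F c) P (ι (Mono? c u v)) ⟩
  respects F c ℤ.* ((1ℤ ℤ.- ι (Mono? c u v)) ℤ.* P)
    ≡⟨ cong (λ t → respects F c ℤ.* t) (properly-suc ends c) ⟨
  respects F c ℤ.* (if properly ends c then 1ℤ else 0ℤ) ∎
  where
  u = proj₁ (ends zero)
  v = proj₂ (ends zero)
  P = if properly (ends ∘ suc) c then 1ℤ else 0ℤ

-- Every colouring respects the discrete partition, so `alt-respects` writes properness as a sum
-- over edge sets; exchanging the sums reduces the count to `count-respects`.
whitney : ∀ {d m} (ends : Ends d m) k →
  + length (filterᵇ (properly ends) (allVecs k d)) ≡ alt ends (λ G → (+ k) ℤ.^ roots G) (discrete d)
whitney {d} {m} ends k = begin
  + length (filterᵇ (properly ends) (allVecs k d))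
    ≡⟨ length-filterᵇ (properly ends) (allVecs k d) ⟩
  sumℤL (λ c → if properly ends c then 1ℤ else 0ℤ) (allVecs k d)
    ≡⟨ sumL-cong (λ c → sym (trans (alt-respects ends (discrete d) c)
         (trans (cong (λ t → t ℤ.* (if properly ends c then 1ℤ else 0ℤ)) (ι-yes (Resp? (discrete d) (Mono? c)) (Resp-discrete d)))
           (ℤₚ.*-identityˡ _)))) (allVecs k d) ⟩
  sumℤL (λ c → alt ends (λ G → respects G c) (discrete d)) (allVecs k d)
    ≡⟨ sumL-swap (λ c A → sgn A ℤ.* respects (state ends A (discrete d)) c) (allVecs k d) (allSubsets m) ⟩
  sumℤL (λ A → sumℤL (λ c → sgn A ℤ.* respects (state ends A (discrete d)) c) (allVecs k d)) (allSubsets m)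
    ≡⟨ sumL-cong (λ A → trans (sumL-*ˡ (sgn A) (respects (state ends A (discrete d))) (allVecs k d))
         (cong (λ t → sgn A ℤ.* t) (count-respects k (state ends A (discrete d))))) (allSubsets m) ⟩
  alt ends (λ G → (+ k) ℤ.^ roots G) (discrete d) ∎

-- The Dirichlet matroid

find-suc : ∀ {d} x (F : Forest d) v → find (x ∷ F) (suc v) ≡ suc (find F v)
find-suc nothing  F v = refl
find-suc (just _) F v = refl

find-eq : ∀ {d} (F : Forest d) → IsEquivalence (λ u v → find F u ≡ find F v)
find-eq F = On.isEquivalence (find F) isEquivalence

first : ∀ {d} → Subset d → Maybe (Fin d)
first []          = nothing
first (true  ∷ B) = just zero
first (false ∷ B) = Maybe.map suc (first B)

first-∈ : ∀ {d} (B : Subset d) {p} → first B ≡ just p → p ∈ B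
first-∈ (true  ∷ B) refl = here
first-∈ (false ∷ B) eq with first B in eq′ | eq
... | just q | refl = there (first-∈ B eq′)

first-just : ∀ {d} {B : Subset d} {s} → s ∈ B → ∃[ p ] first B ≡ just p
first-just here = zero , refl
first-just {B = true  ∷ B} (there s∈) = zero , refl
first-just {B = false ∷ B} (there s∈) with first-just s∈
... | p , eq = suc p , cong (Maybe.map suc) eq

-- The partition whose only nontrivial class is B.
bundle : ∀ {d} → Subset d → Forest d
bundle []          = []
bundle (true  ∷ B) = first B ∷ bundle B
bundle (false ∷ B) = nothing ∷ bundle B

Resp-bundle : ∀ {d} (B : Subset d) {R} → (∀ {s t} → s ∈ B → t ∈ B → R s t) → Resp (bundle B) R
Resp-bundle []          RB = _
Resp-bundle (false ∷ B) RB = Resp-bundle B (λ s∈ t∈ → RB (there s∈) (there t∈))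
Resp-bundle (true  ∷ B) RB with first B in eq
... | nothing = Resp-bundle B (λ s∈ t∈ → RB (there s∈) (there t∈))
... | just p  = RB here (there (first-∈ B eq)) , Resp-bundle B (λ s∈ t∈ → RB (there s∈) (there t∈))

find-bundle : ∀ {d} {B : Subset d} {s t} → s ∈ B → t ∈ B → find (bundle B) s ≡ find (bundle B) t
find-bundle-head : ∀ {d} {B : Subset d} {t} → t ∈ B → find (bundle (true ∷ B)) zero ≡ find (bundle (true ∷ B)) (suc t)
find-bundle-head {B = B} {t} t∈B with first B in eq | first-just t∈B
... | just p | _ = cong suc (find-bundle (first-∈ B eq) t∈B)
find-bundle here here = refl
find-bundle here (there t∈B) = find-bundle-head t∈B
find-bundle (there s∈B) here = sym (find-bundle-head s∈B)
find-bundle {B = x ∷ B} {suc s} {suc t} (there s∈B) (there t∈B) with bundle (x ∷ B) in eq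
... | y ∷ F rewrite find-suc y F s | find-suc y F t with x | eq
...   | true  | refl = cong suc (find-bundle s∈B t∈B)
...   | false | refl = cong suc (find-bundle s∈B t∈B)

roots-bundle : ∀ {d} {B : Subset d} {s} → s ∈ B → roots (bundle B) ≡ suc ∣ ∁ B ∣
roots-bundle {B = B} s∈B with first-just s∈B
... | p , eq = trans (count B) (cong (λ x → extra x ℕ.+ ∣ ∁ B ∣) eq)
  where
  -- Counts the class formed by `B`, which is absent while `B` is empty.
  extra : ∀ {d} → Maybe (Fin d) → ℕ
  extra nothing  = 0
  extra (just _) = 1
  extra-map : ∀ {d} (x : Maybe (Fin d)) → extra (Maybe.map suc x) ≡ extra x
  extra-map nothing  = refl
  extra-map (just _) = refl
  count : ∀ {d} (B : Subset d) → roots (bundle B) ≡ extra (first B) ℕ.+ ∣ ∁ B ∣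
  count [] = refl
  count (false ∷ B) = trans (cong suc (count B)) (trans (sym (ℕₚ.+-suc _ _)) (cong (ℕ._+ _) (sym (extra-map (first B)))))
  count (true ∷ B) with first B | count B
  ... | nothing | eq = cong suc eq
  ... | just _  | eq = eq

-- Recursion on the vector only adds its head, whereas the rank lemmas compare `A` with
-- `A [ e ]≔ inside` for `e` at any position.
subset-ind : ∀ {m} (P : Subset m → Set) → P ⊥ → (∀ A e → P A → P (A [ e ]≔ inside)) → ∀ A → P A
subset-ind P P⊥ step [] = P⊥
subset-ind P P⊥ step (true  ∷ A) = step (false ∷ A) zero (subset-ind (P ∘ (false ∷_)) P⊥ (λ A e → step (false ∷ A) (suc e)) A)
subset-ind P P⊥ step (false ∷ A) = subset-ind (P ∘ (false ∷_)) P⊥ (λ A e → step (false ∷ A) (suc e)) A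

state-⊥ : ∀ {d m} (ends : Ends d m) F → state ends ⊥ F ≡ F
state-⊥ {m = zero}  ends F = refl
state-⊥ {m = suc m} ends F = state-⊥ (ends ∘ suc) F

module _ {d m} (ends : Ends d m) (F : Forest d) (A : Subset m) (e : Fin m) where

  private
    u = proj₁ (ends e)
    v = proj₂ (ends e)

  state-insert⁺ : ∀ {R} → IsEquivalence R → Resp (state ends A F) R → R u v → Resp (state ends (A [ e ]≔ inside) F) R
  state-insert⁺ {R} R-eq rA ruv with Resp-state⁻ R-eq ends A rA
  ... | rF , r = Resp-state⁺ R-eq ends (A [ e ]≔ inside) rF respects′
    where
    respects′ : Respects R-eq ends (A [ e ]≔ inside)
    respects′ k k∈ with k ≟ e
    ... | yes refl = ruv
    ... | no  k≢e  = r k (∈-[]≔⁻ k≢e k∈)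

  state-insert⁻ : ∀ {R} → IsEquivalence R → Resp (state ends (A [ e ]≔ inside) F) R → Resp (state ends A F) R × R u v
  state-insert⁻ R-eq rA′ with Resp-state⁻ R-eq ends (A [ e ]≔ inside) rA′
  ... | rF , r = Resp-state⁺ R-eq ends A rF (λ k → r k ∘ ⊆-insert e) , r e ([]≔-updates A e)

  -- Inserting `e` merges its ends before the later edges, which may give another forest than
  -- merging them last. The partition is the same, hence so is the number of roots.
  roots-insert : roots (state ends (A [ e ]≔ inside) F) ≡ roots (union (state ends A F) u v)
  roots-insert = roots-unique (state ends (A [ e ]≔ inside) F) (union G u v)
    (λ R-eq rA′ → let rA , ruv = state-insert⁻ R-eq rA′ in Resp-union⁺ R-eq G u v rA ruv)
    (λ R-eq rU → let rA , ruv = Resp-union⁻ R-eq G u v rU in state-insert⁺ R-eq rA ruv)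
    where G = state ends A F

dot-sub : ∀ {N} (y v w : Fin N → ℚ) q → dot y (λ x → v x ℚ.- q ℚ.* w x) ≡ dot y v ℚ.- q ℚ.* dot y w
dot-sub y v w q = trans (sumℚ-cong (λ x → cong (λ t → y x ℚ.* (v x ℚ.+ t)) (ℚₚ.neg-distribˡ-* q (w x))))
  (trans (dot-+* (ℚ.- q) y v w) (cong (λ t → dot y v ℚ.+ t) (sym (ℚₚ.neg-distribˡ-* q (dot y w)))))

p-q≡0⇒p≡q : ∀ p q → p ℚ.- q ≡ 0ℚ → p ≡ q
p-q≡0⇒p≡q p q eq = trans
  (ℚS.solve 2 (λ p q → p ℚS.:= (p ℚS.:- q) ℚS.:+ q) refl p q) (trans (cong (λ t → t ℚ.+ q) eq) (ℚₚ.+-identityˡ q))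

1≢0 : 1ℚ ≢ 0ℚ
1≢0 ()

-- Ranks of edge sets with and without `e₀`

module NetworkRank (N : Network) (r : Subset (suc (Network.m N)) → ℕ) (isRank : Network.IsRankFn N r) where

  open Network N
  open LinearMatroid vec
  open Rank r isRank

  -- The value of the functional y at the vertex v, a boundary node j standing for the vector u(j) e₀:
  -- y annihilates an edge if and only if its endpoints have equal potential.
  pot : (Fin (suc d) → ℚ) → Fin d → ℚ
  pot y v = if does (v ∈? B) then uB v ℚ.* y zero else y (suc v)

  Pot : (Fin (suc d) → ℚ) → Fin d → Fin d → Set
  Pot y u v = pot y u ≡ pot y v

  Pot-eq : ∀ y → IsEquivalence (Pot y)
  Pot-eq y = On.isEquivalence (pot y) isEquivalence

  -- The vector of an edge with boundary first endpoint is oriented from its second endpoint, hence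
  -- the two signs.
  dot-edgeVec : ∀ y i j → ¬ (i ∈ B × j ∈ B) →
    (dot y (edgeVec i j) ≡ pot y i ℚ.- pot y j) ⊎ (dot y (edgeVec i j) ≡ pot y j ℚ.- pot y i)
  dot-edgeVec y i j ¬BB with i ∈? B | j ∈? B
  ... | no _ | no _ = inj₁ (begin
    dot y (λ x → unit (suc i) x ℚ.- unit (suc j) x)
      ≡⟨ sumℚ-cong (λ x → cong (λ t → y x ℚ.* (unit (suc i) x ℚ.- t)) (sym (ℚₚ.*-identityˡ (unit (suc j) x)))) ⟩
    dot y (λ x → unit (suc i) x ℚ.- 1ℚ ℚ.* unit (suc j) x)
      ≡⟨ dot-sub y (unit (suc i)) (unit (suc j)) 1ℚ ⟩
    dot y (unit (suc i)) ℚ.- 1ℚ ℚ.* dot y (unit (suc j))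
      ≡⟨ cong₂ (λ p q → p ℚ.- q) (dot-δ y (suc i)) (trans (ℚₚ.*-identityˡ (dot y (unit (suc j)))) (dot-δ y (suc j))) ⟩
    y (suc i) ℚ.- y (suc j) ∎)
  ... | no _ | yes _ = inj₁ (trans (dot-sub y (unit (suc i)) (unit zero) (uB j))
    (cong₂ (λ p q → p ℚ.- uB j ℚ.* q) (dot-δ y (suc i)) (dot-δ y zero)))
  ... | yes _ | no _ = inj₂ (trans (dot-sub y (unit (suc j)) (unit zero) (uB i))
    (cong₂ (λ p q → p ℚ.- uB i ℚ.* q) (dot-δ y (suc j)) (dot-δ y zero)))
  ... | yes i∈B | yes j∈B = contradiction (i∈B , j∈B) ¬BB

  dot-edge⁻ : ∀ y e → dot y (vec (suc e)) ≡ 0ℚ → Pot y (proj₁ (ends e)) (proj₂ (ends e))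
  dot-edge⁻ y e eq with dot-edgeVec y (proj₁ (ends e)) (proj₂ (ends e)) (bdryNonAdj e)
  ... | inj₁ d≡ = p-q≡0⇒p≡q _ _ (trans (sym d≡) eq)
  ... | inj₂ d≡ = sym (p-q≡0⇒p≡q _ _ (trans (sym d≡) eq))

  dot-edge⁺ : ∀ y e → Pot y (proj₁ (ends e)) (proj₂ (ends e)) → dot y (vec (suc e)) ≡ 0ℚ
  dot-edge⁺ y e p≡ with dot-edgeVec y (proj₁ (ends e)) (proj₂ (ends e)) (bdryNonAdj e)
  ... | inj₁ d≡ = trans d≡ (trans (cong (λ t → t ℚ.- pot y (proj₂ (ends e))) p≡) (ℚₚ.+-inverseʳ (pot y (proj₂ (ends e)))))
  ... | inj₂ d≡ = trans d≡ (trans (cong (λ t → pot y (proj₂ (ends e)) ℚ.- t) p≡) (ℚₚ.+-inverseʳ (pot y (proj₂ (ends e)))))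

  pot-∈ : ∀ y {v} → v ∈ B → pot y v ≡ uB v ℚ.* y zero
  pot-∈ y {v} v∈B rewrite dec-true (v ∈? B) v∈B = refl

  -- The flag records whether e₀ belongs to the set, in which case all boundary nodes count as connected.
  base : Bool → Forest d
  base false = discrete d
  base true  = bundle B

  partition : Bool → Subset m → Forest d
  partition b A = state ends A (base b)

  -- Killing `e₀` means `y zero` is 0, and then every boundary node has potential 0. This justifies
  -- starting from `bundle B` when `e₀` is present.
  kills⇒resp : ∀ b A y → Kills (b ∷ A) y → Resp (partition b A) (Pot y)
  kills⇒resp b A y kills = Resp-state⁺ (Pot-eq y) ends A (base-resp b kills) (λ e e∈A → dot-edge⁻ y e (kills (suc e) (there e∈A)))
    where
    base-resp : ∀ b → Kills (b ∷ A) y → Resp (base b) (Pot y)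
    base-resp false _     = Resp-discrete d
    base-resp true  kills = Resp-bundle B (λ s∈B t∈B → trans (pot0 s∈B) (sym (pot0 t∈B)))
      where
      pot0 : ∀ {s} → s ∈ B → pot y s ≡ 0ℚ
      pot0 {s} s∈B = trans (pot-∈ y s∈B)
        (trans (cong (λ t → uB s ℚ.* t) (trans (sym (dot-δ y zero)) (kills zero here))) (ℚₚ.*-zeroʳ (uB s)))

  resp⇒kills : ∀ b A y → (b ≡ true → y zero ≡ 0ℚ) → Resp (partition b A) (Pot y) → Kills (b ∷ A) y
  resp⇒kills b A y y₀ rA zero    here       = trans (dot-δ y zero) (y₀ refl)
  resp⇒kills b A y y₀ rA (suc e) (there e∈A) = dot-edge⁺ y e (proj₂ (Resp-state⁻ (Pot-eq y) ends A rA) e e∈A)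

  -- A merge raises the rank by one and lowers the number of classes by one. By `apart`, one of two
  -- merging classes contains no boundary node; its indicator, extended by 0 at `e₀`, is a potential
  -- that kills the set but not the new edge.
  rank-step : ∀ b A e → let F = partition b A; i = proj₁ (ends e); j = proj₂ (ends e) in
    (∀ {s t} → s ∈ B → t ∈ B → find F s ≡ find F i → find F t ≡ find F j → find F i ≡ find F j) →
    r (b ∷ A [ e ]≔ inside) ℕ.+ roots (partition b (A [ e ]≔ inside)) ≡ r (b ∷ A) ℕ.+ roots F
  rank-step b A e apart rewrite roots-insert ends (base b) A e with union-cases (partition b A) (proj₁ (ends e)) (proj₂ (ends e))
  ... | inj₁ (i~j , U≡F) = cong₂ ℕ._+_
    (rank-stay {b ∷ A} {suc e} (λ y kills → dot-edge⁺ y e (Resp⇒R (Pot-eq y) (partition b A) (kills⇒resp b A y kills) i~j)))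
    (cong roots U≡F)
  ... | inj₂ (i≁j , suc-roots) = trans
    (cong (ℕ._+ roots (union F i j)) (grow (any? i)))
    (trans (sym (ℕₚ.+-suc (r (b ∷ A)) (roots (union F i j)))) (cong (r (b ∷ A) ℕ.+_) suc-roots))
    where
    F = partition b A
    i = proj₁ (ends e)
    j = proj₂ (ends e)
    any? : ∀ k → Dec (∃[ s ] (s ∈ B × find F s ≡ find F k))
    any? k = Fin.any? (λ s → (s ∈? B) ×-dec (find F s ≟ find F k))
    indicator : Fin d → Fin (suc d) → ℚ
    indicator k zero    = 0ℚ
    indicator k (suc v) = δ (find F k) (find F v)
    pot-indicator : ∀ k → ¬ (∃[ s ] (s ∈ B × find F s ≡ find F k)) → ∀ v → pot (indicator k) v ≡ δ (find F k) (find F v)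
    pot-indicator k none v with v ∈? B
    ... | yes v∈B = trans (ℚₚ.*-zeroʳ (uB v)) (sym (δ-off (λ eq → none (v , v∈B , eq))))
    ... | no  _   = refl
    separate : ∀ k → ¬ (∃[ s ] (s ∈ B × find F s ≡ find F k)) →
      δ (find F k) (find F i) ≢ δ (find F k) (find F j) → r (b ∷ A [ e ]≔ inside) ≡ suc (r (b ∷ A))
    separate k none ne = rank-grow {b ∷ A} {suc e} (indicator k)
      (resp⇒kills b A (indicator k) (λ _ → refl) (Resp-mono F
        (λ u v eq → trans (pot-indicator k none u) (trans (cong (δ (find F k)) eq) (sym (pot-indicator k none v)))) (Resp-find F)))
      (λ eq → ne (trans (sym (pot-indicator k none i)) (trans (dot-edge⁻ (indicator k) e eq) (pot-indicator k none j))))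
    grow : Dec (∃[ s ] (s ∈ B × find F s ≡ find F i)) → r (b ∷ A [ e ]≔ inside) ≡ suc (r (b ∷ A))
    grow (no none) = separate i none (λ eq → 1≢0 (trans (sym (δ-diag (find F i))) (trans eq (δ-off (i≁j ∘ sym)))))
    grow (yes (s , s∈B , s~i)) = separate j (λ (t , t∈B , t~j) → i≁j (apart s∈B t∈B s~i t~j))
      (λ eq → 1≢0 (trans (sym (δ-diag (find F j))) (trans (sym eq) (δ-off i≁j))))

  Unbalanced : Forest d → Set
  Unbalanced F = ∃[ s ] ∃[ t ] (s ∈ B × t ∈ B × s ≢ t × find F s ≡ find F t)

  unbalanced? : ∀ F → Dec (Unbalanced F)
  unbalanced? F = Fin.any? λ s → Fin.any? λ t →
    (s ∈? B) ×-dec (t ∈? B) ×-dec ¬? (s ≟ t) ×-dec (find F s ≟ find F t)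

  balanced : ∀ {F} → ¬ Unbalanced F → ∀ {s t} → s ∈ B → t ∈ B → find F s ≡ find F t → s ≡ t
  balanced bal {s} {t} s∈B t∈B s~t = decidable-stable (s ≟ t) (λ s≢t → bal (s , t , s∈B , t∈B , s≢t , s~t))

  rank-∅ : r ⊥ ≡ 0
  rank-∅ with proj₁ (isRank ⊥)
  ... | T , T⊆⊥ , _ , ∣T∣≡ = ℕₚ.n≤0⇒n≡0 (subst₂ ℕ._≤_ ∣T∣≡ (∣⊥∣≡0 (suc m)) (p⊆q⇒∣p∣≤∣q∣ T⊆⊥))

  -- Balance passes to smaller sets, which feeds the induction. If the ends of the new edge lie in
  -- classes with boundary nodes `s` and `t`, the larger partition puts both in one class; its
  -- balance gives `s` equal to `t`, so the ends were already joined.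
  rank-balanced : ∀ A → ¬ Unbalanced (partition false A) → r (false ∷ A) ℕ.+ roots (partition false A) ≡ d
  rank-balanced = subset-ind _
    (λ _ → cong₂ ℕ._+_ rank-∅ (trans (cong roots (state-⊥ ends (discrete d))) (roots-discrete d)))
    step
    where
    step : ∀ A e → (¬ Unbalanced (partition false A) → r (false ∷ A) ℕ.+ roots (partition false A) ≡ d) →
      ¬ Unbalanced (partition false (A [ e ]≔ inside)) →
      r (false ∷ A [ e ]≔ inside) ℕ.+ roots (partition false (A [ e ]≔ inside)) ≡ d
    step A e IH bal′ = trans (rank-step false A e apart) (IH bal)
      where
      F = partition false A
      F′ = partition false (A [ e ]≔ inside)
      coarser = state-insert⁻ ends (base false) A e (find-eq F′) (Resp-find F′)
      F⇒F′ : ∀ {u v} → find F u ≡ find F v → find F′ u ≡ find F′ v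
      F⇒F′ = Resp⇒R (find-eq F′) F (proj₁ coarser)
      bal : ¬ Unbalanced F
      bal (s , t , s∈B , t∈B , s≢t , s~t) = bal′ (s , t , s∈B , t∈B , s≢t , F⇒F′ s~t)
      apart : ∀ {s t} → s ∈ B → t ∈ B → find F s ≡ find F _ → find F t ≡ find F _ → find F _ ≡ find F _
      apart s∈B t∈B s~i t~j
        with balanced {F′} bal′ s∈B t∈B (trans (F⇒F′ s~i) (trans (proj₂ coarser) (sym (F⇒F′ t~j))))
      ... | refl = trans (sym s~i) t~j

  -- The constant is read off at the empty edge set: `e₀` alone has rank 1 and `bundle B` has
  -- `n + 1` classes. The boundary lies in a single class throughout, so `apart` holds
  -- automatically.
  rank-grounded : ∀ A → r (true ∷ A) ℕ.+ roots (partition true A) ≡ suc (suc n)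
  rank-grounded = subset-ind _
    (cong₂ ℕ._+_
      (trans (rank-grow {⊥} {zero} (δ zero) (λ k k∈⊥ → contradiction k∈⊥ ∉⊥)
        (λ eq → 1≢0 (trans (sym (dot-δ {suc d} (δ zero) zero)) eq))) (cong suc rank-∅))
      (trans (cong roots (state-⊥ ends (bundle B))) (roots-bundle (proj₂ b₀))))
    (λ A e → trans (rank-step true A e (apart A)))
    where
    b₀ : ∃ (_∈ B)
    b₀ with nonempty? B
    ... | yes ne = ne
    ... | no  empty = contradiction (subst (λ S → 2 ℕ.≤ ∣ S ∣) (Empty-unique empty) twoBoundary)
                        (subst (λ k → ¬ 2 ℕ.≤ k) (sym (∣⊥∣≡0 d)) λ ())
    apart : ∀ A {i j s t} → s ∈ B → t ∈ B → find (partition true A) s ≡ find (partition true A) i →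
      find (partition true A) t ≡ find (partition true A) j → find (partition true A) i ≡ find (partition true A) j
    apart A s∈B t∈B s~i t~j = trans (sym s~i) (trans s~t t~j)
      where
      F = partition true A
      s~t = Resp⇒R (find-eq F) (bundle B) (proj₁ (Resp-state⁻ (find-eq F) ends A (Resp-find F))) (find-bundle s∈B t∈B)

  along : ∀ {R : Fin d → Fin d → Set} → IsEquivalence R → ∀ {ℓ} (p : Fin (suc ℓ) → Fin d) →
    (∀ i → R (p (inject₁ i)) (p (suc i))) → R (p zero) (p (fromℕ ℓ))
  along R-eq {zero}  p steps = IsEquivalence.refl R-eq
  along R-eq {suc ℓ} p steps = IsEquivalence.trans R-eq (steps zero) (along R-eq (p ∘ suc) (steps ∘ suc))

  -- Connectedness leaves one class, so `rank-grounded` reads `r ⊤ + 1 = n + 2`.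
  rank-⊤ : r ⊤ ≡ suc n
  rank-⊤ = ℕₚ.suc-injective (trans (ℕₚ.+-comm 1 (r ⊤)) (trans (cong (r ⊤ ℕ.+_) (sym one-root)) (rank-grounded ⊤)))
    where
    F = partition true ⊤
    edges : Respects (find-eq F) ends ⊤
    edges = proj₂ (Resp-state⁻ (find-eq F) ends ⊤ (Resp-find F))
    adj : ∀ {u v} → Adj u v → find F u ≡ find F v
    adj (e , inj₁ eq) = subst₂ (λ u v → find F u ≡ find F v) (cong proj₁ eq) (cong proj₂ eq) (edges e ∈⊤)
    adj (e , inj₂ eq) = sym (subst₂ (λ u v → find F u ≡ find F v) (cong proj₁ eq) (cong proj₂ eq) (edges e ∈⊤))
    all-connected : ∀ u v → find F u ≡ find F v
    all-connected u v with connected u v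
    ... | ℓ , p , refl , refl , _ , adjacent = along (find-eq F) p (λ i → adj (adjacent i))
    one-root : roots F ≡ 1
    one-root = roots-connected F (proj₁ properSub) all-connected

  -- Give each class the label `uB` of its boundary node, unique by balance, and 0 if it has none.
  -- With `y zero` equal to 1 these labels are the potentials, so `y` kills `A` but not `e₀`.
  rank-e₀-balanced : ∀ A → ¬ Unbalanced (partition false A) → r (true ∷ A) ≡ suc (r (false ∷ A))
  rank-e₀-balanced A bal = rank-grow {false ∷ A} {zero} y
    (resp⇒kills false A y (λ ()) (Resp-mono F (λ u v eq → trans (pot-y u) (trans (cong label eq) (sym (pot-y v)))) (Resp-find F)))
    (λ eq → 1≢0 (trans (sym (dot-δ y zero)) eq))
    where
    F = partition false A
    label : Fin d → ℚ
    label w with Fin.any? (λ s → (s ∈? B) ×-dec (find F s ≟ w))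
    ... | yes (s , _) = uB s
    ... | no _        = 0ℚ
    y : Fin (suc d) → ℚ
    y zero    = 1ℚ
    y (suc v) = label (find F v)
    pot-y : ∀ v → pot y v ≡ label (find F v)
    pot-y v with v ∈? B
    ... | no _ = refl
    ... | yes v∈B with Fin.any? (λ s → (s ∈? B) ×-dec (find F s ≟ find F v))
    ...   | yes (s , s∈B , s~v) = trans (ℚₚ.*-identityʳ (uB v)) (cong uB (sym (balanced {F} bal s∈B v∈B s~v)))
    ...   | no none = contradiction (v , v∈B , refl) none

  uB-injective : ∀ {s t} → uB s ≡ uB t → s ≡ t
  uB-injective {s} {t} eq with ℚₚ./-injective-≃ (ℚᵘ.mkℚᵘ (+ toℕ s) 0) (ℚᵘ.mkℚᵘ (+ toℕ t) 0) eq
  ... | ℚᵘ.*≡* eq′ = Fin.toℕ-injective (ℤₚ.+-injective (trans (sym (ℤₚ.*-identityʳ (+ toℕ s))) (trans eq′ (ℤₚ.*-identityʳ (+ toℕ t)))))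

  -- A potential constant on a class with two boundary nodes satisfies
  -- `uB s * y zero = uB t * y zero`; injectivity of the labelling forces `y zero` to vanish.
  rank-e₀-unbalanced : ∀ A → Unbalanced (partition false A) → r (true ∷ A) ≡ r (false ∷ A)
  rank-e₀-unbalanced A (s , t , s∈B , t∈B , s≢t , s~t) = rank-stay {false ∷ A} {zero} λ y kills →
    trans (dot-δ y zero) (vanish y
      (trans (sym (pot-∈ y s∈B)) (trans (Resp⇒R (Pot-eq y) (partition false A) (kills⇒resp false A y kills) s~t) (pot-∈ y t∈B))))
    where
    vanish : ∀ y → uB s ℚ.* y zero ≡ uB t ℚ.* y zero → y zero ≡ 0ℚ
    vanish y eq = *-cancel-0 {q = uB s ℚ.- uB t} (λ z → s≢t (uB-injective (p-q≡0⇒p≡q _ _ z)))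
      (begin
        y zero ℚ.* (uB s ℚ.- uB t)  ≡⟨ ℚS.solve 3 (λ y s t → y ℚS.:* (s ℚS.:- t) ℚS.:= s ℚS.:* y ℚS.:- t ℚS.:* y) refl
                                         (y zero) (uB s) (uB t) ⟩
        uB s ℚ.* y zero ℚ.- uB t ℚ.* y zero  ≡⟨ cong (λ q → q ℚ.- uB t ℚ.* y zero) eq ⟩
        uB t ℚ.* y zero ℚ.- uB t ℚ.* y zero  ≡⟨ ℚₚ.+-inverseʳ (uB t ℚ.* y zero) ⟩
        0ℚ ∎)

-- Paths inside a class

-- At most one element of `S` is a root, so at least `∣ S ∣ - 1` vertices are not.
class-size : ∀ {d} (F : Forest d) (S : Subset d) → (∀ {u v} → u ∈ S → v ∈ S → find F u ≡ find F v) →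
  ∣ S ∣ ℕ.+ roots F ≤ suc d
class-size []            []          same = ℕ.z≤n
class-size (nothing ∷ F) (false ∷ S) same = ℕₚ.≤-trans (ℕₚ.≤-reflexive (ℕₚ.+-suc ∣ S ∣ (roots F)))
  (ℕ.s≤s (class-size F S (λ u∈ v∈ → Fin.suc-injective (same (there u∈) (there v∈)))))
class-size {suc d} (nothing ∷ F) (true ∷ S) same = ℕ.s≤s
  (subst (λ k → k ℕ.+ suc (roots F) ≤ suc d) (sym (trans (cong ∣_∣ (Empty-unique empty)) (∣⊥∣≡0 d))) (ℕ.s≤s (roots≤ F)))
  where
  empty : ¬ ∃ (_∈ S)
  empty (v , v∈S) with same here (there v∈S)
  ... | ()
class-size (just p ∷ F) (false ∷ S) same = ℕₚ.m≤n⇒m≤1+n (class-size F S (λ u∈ v∈ → Fin.suc-injective (same (there u∈) (there v∈))))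
class-size (just p ∷ F) (true  ∷ S) same = ℕ.s≤s (class-size F S (λ u∈ v∈ → Fin.suc-injective (same (there u∈) (there v∈))))

image : ∀ {k d} → (Fin k → Fin d) → Subset d
image {zero}  p = ⊥
image {suc k} p = image (p ∘ suc) [ p zero ]≔ inside

∈-image⁻ : ∀ {k d} (p : Fin k → Fin d) {v} → v ∈ image p → ∃[ i ] p i ≡ v
∈-image⁻ {zero}  p v∈ = contradiction v∈ ∉⊥
∈-image⁻ {suc k} p {v} v∈ with v ≟ p zero
... | yes v≡ = zero , sym v≡
... | no  v≢ with ∈-image⁻ (p ∘ suc) (∈-[]≔⁻ v≢ v∈)
...   | i , eq = suc i , eq

∣image∣ : ∀ {k d} (p : Fin k → Fin d) → (∀ i j → p i ≡ p j → i ≡ j) → ∣ image p ∣ ≡ k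
∣image∣ {zero}  {d} p inj = ∣⊥∣≡0 d
∣image∣ {suc k} p inj = trans (∣insert∣ (image (p ∘ suc)) fresh)
  (cong suc (∣image∣ (p ∘ suc) (λ i j eq → Fin.suc-injective (inj (suc i) (suc j) eq))))
  where
  fresh : p zero ∉ image (p ∘ suc)
  fresh p₀∈ with ∈-image⁻ (p ∘ suc) p₀∈
  ... | i , eq with inj (suc i) zero eq
  ...   | ()

module Paths (Γ : Graph) where

  open Graph Γ

  PathIn : (Fin d → Set) → Fin d → Fin d → Set
  PathIn Q s t = ∃[ ℓ ] Σ (Fin (suc ℓ) → Fin d) λ p → IsPath ℓ p s t × (∀ i → Q (p i))

  suffix : ∀ {Q ℓ p s t} → IsPath ℓ p s t → (∀ i → Q (p i)) → ∀ i → PathIn Q (p i) t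
  suffix {ℓ = ℓ} {p} (_ , end , inj , adj) Qp zero = ℓ , p , (refl , end , inj , adj) , Qp
  suffix {Q} {suc ℓ} {p} (_ , end , inj , adj) Qp (suc i) =
    suffix {Q} {p = p ∘ suc} (refl , end , (λ i j eq → Fin.suc-injective (inj (suc i) (suc j) eq)) , adj ∘ suc) (Qp ∘ suc) i

  -- Loop erasure: if `u` already lies on the path, the part from its occurrence onwards is kept
  -- instead.
  prepend : ∀ {Q u s t} → Adj u s → Q u → PathIn Q s t → PathIn Q u t
  prepend {Q} {u} u~s Qu (ℓ , p , path@(refl , end , inj , adj) , Qp) with Fin.any? (λ i → p i ≟ u)
  ... | yes (i , refl) = suffix {Q} path Qp i
  ... | no fresh = suc ℓ , q , (refl , end , q-inj , q-adj) , λ { zero → Qu ; (suc i) → Qp i }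
    where
    q : Fin (suc (suc ℓ)) → Fin d
    q zero    = u
    q (suc i) = p i
    q-inj : ∀ i j → q i ≡ q j → i ≡ j
    q-inj zero    zero    eq = refl
    q-inj zero    (suc j) eq = contradiction (j , sym eq) fresh
    q-inj (suc i) zero    eq = contradiction (i , eq) fresh
    q-inj (suc i) (suc j) eq = cong suc (inj i j eq)
    q-adj : ∀ i → Adj (q (inject₁ i)) (q (suc i))
    q-adj zero    = u~s
    q-adj (suc i) = adj i

  module _ (A : Subset m) where

    private
      F = state ends A (discrete d)

    -- Recording the class confines the resulting path to a single class, whose size will bound its
    -- length.
    Step : Fin d → Fin d → Set
    Step u v = Adj u v × find F u ≡ find F v

    Star-eq : IsEquivalence (Star Step)
    Star-eq = record
      { refl  = ε
      ; sym   = reverse (λ { ((e , eq) , same) → (e , swap eq) , sym same })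
      ; trans = _◅◅_
      }

    connect : ∀ {s t} → find F s ≡ find F t → Star Step s t
    connect = Resp⇒R Star-eq F (Resp-state⁺ Star-eq ends A (Resp-discrete d)
      (λ e e∈A → ((e , inj₁ refl) , proj₂ (Resp-state⁻ (find-eq F) ends A (Resp-find F)) e e∈A) ◅ ε))

    simple : ∀ {s t} → Star Step s t → PathIn (λ v → find F v ≡ find F t) s t
    simple {s} ε = 0 , (λ _ → s) , (refl , refl , (λ { zero zero _ → refl }) , λ ()) , λ _ → refl
    simple (step ◅ steps) with simple steps
    ... | path@(ℓ , p , (refl , _) , Qp) = prepend {λ v → find F v ≡ find F _} (proj₁ step) (trans (proj₂ step) (Qp zero)) path

    -- The `ℓ + 1` distinct vertices lie in one class, so `class-size` gives
    -- `ℓ + 1 + roots F ≤ d + 1`.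
    short-path : ∀ {s t} → find F s ≡ find F t → ∃[ ℓ ] Σ (Fin (suc ℓ) → Fin d) λ p → IsPath ℓ p s t × ℓ ≤ ρ F
    short-path s~t with simple (connect s~t)
    ... | ℓ , p , path@(_ , _ , inj , _) , same = ℓ , p , path ,
      ℕₚ.m+n≤o⇒m≤o∸n ℓ (ℕₚ.≤-pred (subst (λ k → k ℕ.+ roots F ≤ suc d) (∣image∣ p inj) (class-size F (image p) same′)))
      where
      same′ : ∀ {u v} → u ∈ image p → v ∈ image p → find F u ≡ find F v
      same′ u∈ v∈ with ∈-image⁻ p u∈ | ∈-image⁻ p v∈
      ... | i , refl | j , refl = trans (same i) (sym (same j))

-- Comparison of coefficients

-1^-square : ∀ i → -1ℤ ℤ.^ i ℤ.* -1ℤ ℤ.^ i ≡ 1ℤ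
-1^-square zero    = refl
-1^-square (suc i) = trans
  (ℤS.solve 1 (λ s → (ℤS.con -1ℤ ℤS.:* s) ℤS.:* (ℤS.con -1ℤ ℤS.:* s) ℤS.:= s ℤS.:* s) refl (-1ℤ ℤ.^ i)) (-1^-square i)

module Comparison (N : Network) (r : Subset (suc (Network.m N)) → ℕ) (isRank : Network.IsRankFn N r) where

  open Network N
  open NetworkRank N r isRank

  rank≤ : ∀ S → r S ≤ r ⊤
  rank≤ S with proj₁ (isRank S)
  ... | T , T⊆S , indep , ∣T∣≡ = subst (_≤ r ⊤) ∣T∣≡ (proj₂ (isRank ⊤) T ⊆⊤ indep)

  class : Subset m → Forest d
  class A = state ends A (discrete d)

  rank≡ρ : ∀ A → ¬ Unbalanced (class A) → r (false ∷ A) ≡ ρ (class A)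
  rank≡ρ A bal = trans (sym (ℕₚ.m+n∸n≡m (r (false ∷ A)) (roots (class A)))) (cong (_∸ roots (class A)) (rank-balanced A bal))

  -- Comparing `A` with `e₀` added to the whole ground set gives `ρ + 1 ≤ n + 1`. Exponents `n ∸ ρ`
  -- are therefore genuine differences.
  ρ≤n : ∀ A → ¬ Unbalanced (class A) → ρ (class A) ≤ n
  ρ≤n A bal = ℕₚ.≤-pred (subst₂ _≤_ (trans (rank-e₀-balanced A bal) (cong suc (rank≡ρ A bal))) rank-⊤ (rank≤ (true ∷ A)))

  bal : Forest d → ℤ
  bal F = ι (¬? (unbalanced? F))

  charPoly-alt : ∀ x → charPoly r x ≡ (x ℤ.- 1ℤ) ℤ.* alt ends (λ F → bal F ℤ.* x ℤ.^ (n ∸ ρ F)) (discrete d)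
  charPoly-alt x = begin
    charPoly r x
      ≡⟨ sumL-allSubsets (λ S → sgn S ℤ.* x ℤ.^ (r ⊤ ∸ r S)) ⟩
    sumℤL (λ A → sgn (true ∷ A) ℤ.* x ℤ.^ (r ⊤ ∸ r (true ∷ A)) ℤ.+ sgn A ℤ.* x ℤ.^ (r ⊤ ∸ r (false ∷ A))) (allSubsets m)
      ≡⟨ sumL-cong pair (allSubsets m) ⟩
    sumℤL (λ A → (x ℤ.- 1ℤ) ℤ.* (sgn A ℤ.* (bal (class A) ℤ.* x ℤ.^ (n ∸ ρ (class A))))) (allSubsets m)
      ≡⟨ sumL-*ˡ (x ℤ.- 1ℤ) (λ A → sgn A ℤ.* (bal (class A) ℤ.* x ℤ.^ (n ∸ ρ (class A)))) (allSubsets m) ⟩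
    (x ℤ.- 1ℤ) ℤ.* alt ends (λ F → bal F ℤ.* x ℤ.^ (n ∸ ρ F)) (discrete d) ∎
    where
    pair : ∀ A → sgn (true ∷ A) ℤ.* x ℤ.^ (r ⊤ ∸ r (true ∷ A)) ℤ.+ sgn A ℤ.* x ℤ.^ (r ⊤ ∸ r (false ∷ A)) ≡
                 (x ℤ.- 1ℤ) ℤ.* (sgn A ℤ.* (bal (class A) ℤ.* x ℤ.^ (n ∸ ρ (class A))))
    pair A = by-balance (unbalanced? (class A))
      where
      z = x ℤ.^ (n ∸ ρ (class A))
      by-balance : (D : Dec (Unbalanced (class A))) →
        sgn (true ∷ A) ℤ.* x ℤ.^ (r ⊤ ∸ r (true ∷ A)) ℤ.+ sgn A ℤ.* x ℤ.^ (r ⊤ ∸ r (false ∷ A)) ≡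
        (x ℤ.- 1ℤ) ℤ.* (sgn A ℤ.* (ι (¬? D) ℤ.* z))
      by-balance (yes unb) = trans
        (cong (λ k → sgn (true ∷ A) ℤ.* x ℤ.^ (r ⊤ ∸ k) ℤ.+ sgn A ℤ.* x ℤ.^ (r ⊤ ∸ r (false ∷ A))) (rank-e₀-unbalanced A unb))
        (ℤS.solve 4 (λ s y x z → (ℤS.con -1ℤ ℤS.:* s) ℤS.:* y ℤS.:+ s ℤS.:* y ℤS.:=
                      (x ℤS.:- ℤS.con 1ℤ) ℤS.:* (s ℤS.:* (ℤS.con 0ℤ ℤS.:* z))) refl
          (sgn A) (x ℤ.^ (r ⊤ ∸ r (false ∷ A))) x z)
      by-balance (no bal) = trans
        (cong₂ (λ p q → sgn (true ∷ A) ℤ.* x ℤ.^ p ℤ.+ sgn A ℤ.* x ℤ.^ q)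
          (cong₂ _∸_ rank-⊤ (trans (rank-e₀-balanced A bal) (cong suc (rank≡ρ A bal))))
          (trans (cong₂ _∸_ rank-⊤ (rank≡ρ A bal)) (ℕₚ.+-∸-assoc 1 (ρ≤n A bal))))
        (ℤS.solve 3 (λ s x z → (ℤS.con -1ℤ ℤS.:* s) ℤS.:* z ℤS.:+ s ℤS.:* (x ℤS.:* z) ℤS.:=
                      (x ℤS.:- ℤS.con 1ℤ) ℤS.:* (s ℤS.:* (ℤS.con 1ℤ ℤS.:* z))) refl
          (sgn A) x z)

  -- Coefficients with their signs (-1)^i included. The factor `1ℤ` is the constant weight in the
  -- form that `poly-alt` takes.
  chromaticCoeff precoloringCoeff gap : ℕ → ℤ
  chromaticCoeff   i = alt ends (λ F → 1ℤ ℤ.* ι (ρ F ℕ.≟ i)) (discrete d)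
  precoloringCoeff i = alt ends (λ F → bal F ℤ.* ι (ρ F ℕ.≟ i)) (discrete d)
  gap              i = alt ends (λ F → ι (unbalanced? F) ℤ.* ι (ρ F ℕ.≟ i)) (discrete d)

  module _ (a : ℕ → ℤ) (a-spec : ∀ k → + numColourings k ≡ altPoly d a (+ k)) where

    chromatic : ∀ {i} → i ≤ d → -1ℤ ℤ.^ i ℤ.* a i ≡ chromaticCoeff i
    chromatic = poly-unique d (λ i → -1ℤ ℤ.^ i ℤ.* a i) chromaticCoeff λ k → let x = + suc (suc k) in begin
      altPoly d a x  ≡⟨ a-spec (suc (suc k)) ⟨
      + numColourings (suc (suc k))  ≡⟨ whitney ends (suc (suc k)) ⟩
      alt ends (λ F → x ℤ.^ roots F) (discrete d)
        ≡⟨ sumL-cong (λ A → cong (λ t → sgn A ℤ.* t) (sym (trans (ℤₚ.*-identityˡ (x ℤ.^ (d ∸ ρ (class A))))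
             (cong (x ℤ.^_) (ℕₚ.m∸[m∸n]≡n (roots≤ (class A))))))) (allSubsets m) ⟩
      alt ends (λ F → 1ℤ ℤ.* x ℤ.^ (d ∸ ρ F)) (discrete d)
        ≡⟨ poly-alt ends (λ _ → 1ℤ) (discrete d) d x (λ A → inj₂ (ℕₚ.m∸n≤m d (roots (class A)))) ⟨
      poly d chromaticCoeff x ∎

  module _ (b : ℕ → ℤ) (b-spec : ∀ x → (x ℤ.- 1ℤ) ℤ.* altPoly n b x ≡ charPoly r x) where

    precoloring : ∀ {i} → i ≤ n → -1ℤ ℤ.^ i ℤ.* b i ≡ precoloringCoeff i
    precoloring = poly-unique n (λ i → -1ℤ ℤ.^ i ℤ.* b i) precoloringCoeff λ k → let x = + suc (suc k) in begin
      altPoly n b x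
        ≡⟨ ℤₚ.*-cancelˡ-≡ (x ℤ.- 1ℤ) (altPoly n b x) (alt ends (λ F → bal F ℤ.* x ℤ.^ (n ∸ ρ F)) (discrete d))
             (trans (b-spec x) (charPoly-alt x)) ⟩
      alt ends (λ F → bal F ℤ.* x ℤ.^ (n ∸ ρ F)) (discrete d)
        ≡⟨ poly-alt ends bal (discrete d) n x small ⟨
      poly n precoloringCoeff x ∎
      where
      small : ∀ A → bal (class A) ≡ 0ℤ ⊎ ρ (class A) ≤ n
      small A with unbalanced? (class A)
      ... | yes _   = inj₁ refl
      ... | no  bal = inj₂ (ρ≤n A bal)

  coeff-split : ∀ i → chromaticCoeff i ≡ precoloringCoeff i ℤ.+ gap i
  coeff-split i = trans (sumL-cong split (allSubsets m))
    (sumL-+ (λ A → sgn A ℤ.* (bal (class A) ℤ.* ι (ρ (class A) ℕ.≟ i)))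
            (λ A → sgn A ℤ.* (ι (unbalanced? (class A)) ℤ.* ι (ρ (class A) ℕ.≟ i))) (allSubsets m))
    where
    split : ∀ A → sgn A ℤ.* (1ℤ ℤ.* ι (ρ (class A) ℕ.≟ i)) ≡
      sgn A ℤ.* (bal (class A) ℤ.* ι (ρ (class A) ℕ.≟ i)) ℤ.+ sgn A ℤ.* (ι (unbalanced? (class A)) ℤ.* ι (ρ (class A) ℕ.≟ i))
    split A = trans
      (ℤS.solve 3 (λ s u p → s ℤS.:* (ℤS.con 1ℤ ℤS.:* p) ℤS.:= s ℤS.:* ((ℤS.con 1ℤ ℤS.:- u) ℤS.:* p) ℤS.:+ s ℤS.:* (u ℤS.:* p)) refl
        (sgn A) (ι (unbalanced? (class A))) (ι (ρ (class A) ℕ.≟ i)))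
      (cong (λ t → sgn A ℤ.* (t ℤ.* ι (ρ (class A) ℕ.≟ i)) ℤ.+ sgn A ℤ.* (ι (unbalanced? (class A)) ℤ.* ι (ρ (class A) ℕ.≟ i)))
        (sym (ι-¬ (unbalanced? (class A)))))

  gap-sign : ∀ i → 0ℤ ℤ.≤ -1ℤ ℤ.^ i ℤ.* gap i
  gap-sign i = subst (0ℤ ℤ.≤_) simplify (alt-sign ends W W-sign (discrete d))
    where
    -- In rank `i` there are `d - i` classes, so `s` makes the signed weight equal to 1 there. At
    -- the discrete start, with `d` classes, the factor (-1)^d cancels and (-1)^i remains.
    s = -1ℤ ℤ.^ i ℤ.* -1ℤ ℤ.^ d
    W : Forest d → ℤ
    W F = s ℤ.* (ι (unbalanced? F) ℤ.* ι (ρ F ℕ.≟ i))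
    W-sign : ∀ F → 0ℤ ℤ.≤ -1ℤ ℤ.^ roots F ℤ.* W F
    W-sign F = by-cases (unbalanced? F) (ρ F ℕ.≟ i)
      where
      by-cases : (D : Dec (Unbalanced F)) (E : Dec (ρ F ≡ i)) → 0ℤ ℤ.≤ -1ℤ ℤ.^ roots F ℤ.* (s ℤ.* (ι D ℤ.* ι E))
      by-cases (no _)  E       = ℤₚ.≤-reflexive (sym
        (ℤS.solve 3 (λ e s p → e ℤS.:* (s ℤS.:* (ℤS.con 0ℤ ℤS.:* p)) ℤS.:= ℤS.con 0ℤ) refl (-1ℤ ℤ.^ roots F) s (ι E)))
      by-cases (yes _) (no _)  = ℤₚ.≤-reflexive (sym
        (ℤS.solve 2 (λ e s → e ℤS.:* (s ℤS.:* ℤS.con 0ℤ) ℤS.:= ℤS.con 0ℤ) refl (-1ℤ ℤ.^ roots F) s))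
      by-cases (yes _) (yes ρ≡i) = subst (0ℤ ℤ.≤_) (sym even) (ℤ.+≤+ ℕ.z≤n)
        where
        e = -1ℤ ℤ.^ roots F
        even : e ℤ.* (s ℤ.* 1ℤ) ≡ 1ℤ
        even = begin
          e ℤ.* (-1ℤ ℤ.^ i ℤ.* -1ℤ ℤ.^ d ℤ.* 1ℤ)
            ≡⟨ ℤS.solve 3 (λ e s t → e ℤS.:* (s ℤS.:* t ℤS.:* ℤS.con 1ℤ) ℤS.:= (e ℤS.:* s) ℤS.:* t) refl e (-1ℤ ℤ.^ i) (-1ℤ ℤ.^ d) ⟩
          (e ℤ.* -1ℤ ℤ.^ i) ℤ.* -1ℤ ℤ.^ d
            ≡⟨ cong (λ t → t ℤ.* -1ℤ ℤ.^ d) (trans (sym (ℤₚ.^-distribˡ-+-* -1ℤ (roots F) i))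
                 (cong (-1ℤ ℤ.^_) (trans (cong (roots F ℕ.+_) (sym ρ≡i)) (ℕₚ.m+[n∸m]≡n (roots≤ F))))) ⟩
          -1ℤ ℤ.^ d ℤ.* -1ℤ ℤ.^ d  ≡⟨ -1^-square d ⟩
          1ℤ ∎
    simplify : -1ℤ ℤ.^ roots (discrete d) ℤ.* alt ends W (discrete d) ≡ -1ℤ ℤ.^ i ℤ.* gap i
    simplify = begin
      -1ℤ ℤ.^ roots (discrete d) ℤ.* alt ends W (discrete d)
        ≡⟨ cong₂ (λ k g → -1ℤ ℤ.^ k ℤ.* g) (roots-discrete d) pull ⟩
      -1ℤ ℤ.^ d ℤ.* (s ℤ.* gap i)
        ≡⟨ ℤS.solve 3 (λ e s g → e ℤS.:* (s ℤS.:* e ℤS.:* g) ℤS.:= (e ℤS.:* e) ℤS.:* (s ℤS.:* g)) refl (-1ℤ ℤ.^ d) (-1ℤ ℤ.^ i) (gap i) ⟩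
      (-1ℤ ℤ.^ d ℤ.* -1ℤ ℤ.^ d) ℤ.* (-1ℤ ℤ.^ i ℤ.* gap i)
        ≡⟨ cong (λ t → t ℤ.* (-1ℤ ℤ.^ i ℤ.* gap i)) (-1^-square d) ⟩
      1ℤ ℤ.* (-1ℤ ℤ.^ i ℤ.* gap i)  ≡⟨ ℤₚ.*-identityˡ _ ⟩
      -1ℤ ℤ.^ i ℤ.* gap i ∎
      where
      u : Subset m → ℤ
      u A = ι (unbalanced? (class A)) ℤ.* ι (ρ (class A) ℕ.≟ i)
      pull : alt ends W (discrete d) ≡ s ℤ.* gap i
      pull = trans
        (sumL-cong (λ A → ℤS.solve 3 (λ g s u → g ℤS.:* (s ℤS.:* u) ℤS.:= s ℤS.:* (g ℤS.:* u)) refl (sgn A) s (u A)) (allSubsets m))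
        (sumL-*ˡ s (λ A → sgn A ℤ.* u A) (allSubsets m))

  gap-vanishes : ∀ i → BelowBoundaryDistance i → gap i ≡ 0ℤ
  gap-vanishes i below = trans (sumL-cong vanish (allSubsets m)) (sumL-0 (allSubsets m))
    where
    vanish : ∀ A → sgn A ℤ.* (ι (unbalanced? (class A)) ℤ.* ι (ρ (class A) ℕ.≟ i)) ≡ 0ℤ
    vanish A = by-balance (unbalanced? (class A))
      where
      by-balance : (D : Dec (Unbalanced (class A))) → sgn A ℤ.* (ι D ℤ.* ι (ρ (class A) ℕ.≟ i)) ≡ 0ℤ
      by-balance (no _) = ℤS.solve 2 (λ s p → s ℤS.:* (ℤS.con 0ℤ ℤS.:* p) ℤS.:= ℤS.con 0ℤ) refl (sgn A) (ι (ρ (class A) ℕ.≟ i))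
      by-balance (yes (s , t , s∈B , t∈B , s≢t , s~t)) with Paths.short-path Γ A s~t
      ... | ℓ , p , path , ℓ≤ρ = trans
        (cong (λ q → sgn A ℤ.* (1ℤ ℤ.* q)) (ι-no (ρ (class A) ℕ.≟ i) ρ≢i))
        (ℤₚ.*-zeroʳ (sgn A))
        where
        ρ≢i : ρ (class A) ≢ i
        ρ≢i refl = ℕₚ.<⇒≱ (below s t s∈B t∈B s≢t ℓ p path) ℓ≤ρ

theorem1p2 : (N : Network) → let open Network N in
    (r : Subset (Data.Nat.suc m) → ℕ) → IsRankFn r →
    (a b : ℕ → ℤ) →
    (∀ (k : ℕ) → + numColourings k ≡ altPoly d a (+ k)) →
    (∀ (x : ℤ) → (x ℤ.- 1ℤ) ℤ.* altPoly n b x ≡ charPoly r x) →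
    (∀ i → i ≤ n → b i ℤ.≤ a i)
    × (∀ i → i ≤ n → BelowBoundaryDistance i → a i ≡ b i)
theorem1p2 N r isRank a b a-spec b-spec = bounded , equal
  where
  open Network N
  open Comparison N r isRank
  -- Both coefficient formulas carry the sign (-1)^i; multiplying their difference by it once more
  -- removes it.
  gap≡ : ∀ i → i ≤ n → -1ℤ ℤ.^ i ℤ.* gap i ≡ a i ℤ.- b i
  gap≡ i i≤n = begin
    s ℤ.* gap i
      ≡⟨ ℤS.solve 3 (λ s p g → s ℤS.:* g ℤS.:= s ℤS.:* ((p ℤS.:+ g) ℤS.:- p)) refl s (precoloringCoeff i) (gap i) ⟩
    s ℤ.* (precoloringCoeff i ℤ.+ gap i ℤ.- precoloringCoeff i)
      ≡⟨ cong₂ (λ p q → s ℤ.* (p ℤ.- q)) (trans (chromatic a a-spec (ℕₚ.≤-trans i≤n (∣p∣≤n (∁ B)))) (coeff-split i))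
           (precoloring b b-spec i≤n) ⟨
    s ℤ.* (s ℤ.* a i ℤ.- s ℤ.* b i)
      ≡⟨ ℤS.solve 3 (λ s a b → s ℤS.:* (s ℤS.:* a ℤS.:- s ℤS.:* b) ℤS.:= (s ℤS.:* s) ℤS.:* (a ℤS.:- b)) refl s (a i) (b i) ⟩
    (s ℤ.* s) ℤ.* (a i ℤ.- b i)
      ≡⟨ cong (λ t → t ℤ.* (a i ℤ.- b i)) (-1^-square i) ⟩
    1ℤ ℤ.* (a i ℤ.- b i)  ≡⟨ ℤₚ.*-identityˡ _ ⟩
    a i ℤ.- b i ∎
    where s = -1ℤ ℤ.^ i
  bounded : ∀ i → i ≤ n → b i ℤ.≤ a i
  bounded i i≤n = ℤₚ.0≤i-j⇒j≤i (subst (0ℤ ℤ.≤_) (gap≡ i i≤n) (gap-sign i))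
  equal : ∀ i → i ≤ n → BelowBoundaryDistance i → a i ≡ b i
  equal i i≤n below = ℤₚ.i-j≡0⇒i≡j (a i) (b i) (trans (sym (gap≡ i i≤n))
    (trans (cong (λ t → -1ℤ ℤ.^ i ℤ.* t) (gap-vanishes i below)) (ℤₚ.*-zeroʳ (-1ℤ ℤ.^ i))))
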